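{- Let $\widetilde{s}_n$ be the number of unlabeled split graphs on $n$ vertices and let $s_n$ be the number of labeled split graphs on $n$ vertices. Then $\widetilde{s}_n\sim s_n/n!$ as $n\to\infty$.
   Context: Graphs are finite and simple. A split graph is a graph whose vertices can be partitioned into two (possibly empty) sets $K$ and $S$ such that $K$ is a clique and $S$ is a stable (independent) set. Labeled graphs on $n$ vertices are graphs with vertex set $\{1,\dots,n\}$; unlabeled graphs on $n$ vertices are isomorphism classes of graphs on $n$ vertices. The notation $x_n\sim y_n$ means $\lim_{n\to\infty}x_n/y_n=1$. -}

module Defs where

open import Data.Bool using (Bool; true; false; T; _∧_; _∨_; not)
import Data.Bool.Properties as Bool
open import Data.Fin using (Fin; zero; suc; finToFun; funToFin)
import Data.Fin.Properties as Fin
open import Data.Fin.Permutation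
  using (Permutation′; permutation; id; flip; _∘ₚ_; _⟨$⟩ʳ_; _⟨$⟩ˡ_; inverseˡ; inverseʳ)
open import Data.Fin.Subset using (Subset; _∈_; ∁)
open import Data.Fin.Subset.Properties using (_∈?_; anySubset?)
open import Data.List using (List; []; _∷_; map; mapMaybe; allFin; deduplicate; length; lookup)
open import Data.List.Membership.Propositional.Properties using (∈-allFin; ∈-lookup)
import Data.List.Relation.Unary.All as All
open import Data.List.Relation.Unary.AllPairs using (_∷_)
import Data.List.Relation.Unary.Any as Any
import Data.List.Relation.Unary.Any.Properties as Any
open import Data.List.Relation.Unary.Enumerates.Setoid using (IsEnumeration)
open import Data.List.Relation.Unary.Enumerates.Setoid.Properties
  using (deduplicate⁺; lookup-surjective)
open import Data.List.Relation.Unary.Unique.Setoid using (Unique)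
open import Data.List.Relation.Unary.Unique.DecSetoid.Properties using (deduplicate-!)
open import Data.Maybe using (Maybe; just; nothing)
import Data.Maybe.Relation.Unary.Any as MAny
open import Data.Nat using (ℕ; _^_; _≥_)
open import Data.Product using (Σ; Σ-syntax; ∃-syntax; _×_; _,_; proj₁; proj₂)
open import Data.Rational using (ℚ; 0ℚ; 1ℚ; NonZero; _÷_; _-_; ∣_∣; _<_)
open import Function using (_∘_; Bijection; mk⇔)
open import Level using (0ℓ)
open import Relation.Binary using (DecSetoid; Setoid; IsDecEquivalence)
import Relation.Binary.Construct.On as On
open import Relation.Binary.PropositionalEquality as ≡
  using (_≡_; _≢_; refl; sym; trans; cong; cong₂; subst)
open import Relation.Nullary using (Dec; yes; no; ¬_; ¬?; contradiction; _×-dec_; _→-dec_)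
import Relation.Nullary.Decidable as Dec

-- The vertex set {1,…,n} is represented by Fin n.
record Graph (n : ℕ) : Set where
  field
    adj    : Fin n → Fin n → Bool
    symm   : ∀ i j → adj i j ≡ adj j i
    irrefl : ∀ i → adj i i ≡ false

open Graph public

module _ {n : ℕ} where

  Adjacent : Graph n → Fin n → Fin n → Set
  Adjacent G i j = T (adj G i j)

  IsClique : Graph n → Subset n → Set
  IsClique G K = ∀ i j → i ∈ K → j ∈ K → i ≢ j → Adjacent G i j

  IsStable : Graph n → Subset n → Set
  IsStable G S = ∀ i j → i ∈ S → j ∈ S → ¬ Adjacent G i j

  IsSplit : Graph n → Set
  IsSplit G = ∃[ K ] IsClique G K × IsStable G (∁ K)

  -- Equality of labeled graphs.  It is stated pointwise because Agda has no
  -- function extensionality.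

  infix 4 _≈_ _≅_

  _≈_ : Graph n → Graph n → Set
  G ≈ H = ∀ i j → adj G i j ≡ adj H i j

  _≅_ : Graph n → Graph n → Set
  G ≅ H = Σ[ σ ∈ Permutation′ n ] ∀ i j → adj G i j ≡ adj H (σ ⟨$⟩ʳ i) (σ ⟨$⟩ʳ j)

module _ {n : ℕ} where

  isSplit? : (G : Graph n) → Dec (IsSplit G)
  isSplit? G = anySubset? λ K → isClique? K ×-dec isStable? (∁ K)
    where
    isClique? : ∀ K → Dec (IsClique G K)
    isClique? K = Fin.all? λ i → Fin.all? λ j →
      (i ∈? K) →-dec (j ∈? K) →-dec ¬? (i Fin.≟ j) →-dec Bool.T? (adj G i j)

    isStable? : ∀ S → Dec (IsStable G S)
    isStable? S = Fin.all? λ i → Fin.all? λ j →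
      (i ∈? S) →-dec (j ∈? S) →-dec ¬? (Bool.T? (adj G i j))

  isSplit-resp-≈ : (G H : Graph n) → G ≈ H → IsSplit G → IsSplit H
  isSplit-resp-≈ G H G≈H (K , clique , stable) =
    K , (λ i j i∈ j∈ i≢j → subst T (G≈H i j) (clique i j i∈ j∈ i≢j))
      , (λ i j i∈ j∈ → stable i j i∈ j∈ ∘ subst T (sym (G≈H i j)))

  _≈?_ : (G H : Graph n) → Dec (G ≈ H)
  G ≈? H = Fin.all? λ i → Fin.all? λ j → adj G i j Bool.≟ adj H i j

  -- Search through all pairs (f , g) of endofunctions of Fin n, each coded by
  -- an element of Fin (n ^ n), for an isomorphism f with inverse g.

  _≅?_ : (G H : Graph n) → Dec (G ≅ H)
  G ≅? H = Dec.map′ to from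
    (Fin.any? λ c → Fin.any? λ d → isIso? (finToFun c) (finToFun d))
    where
    IsIso : (f g : Fin n → Fin n) → Set
    IsIso f g = (∀ i → f (g i) ≡ i) × (∀ i → g (f i) ≡ i)
              × (∀ i j → adj G i j ≡ adj H (f i) (f j))

    isIso? : ∀ f g → Dec (IsIso f g)
    isIso? f g = Fin.all? (λ i → f (g i) Fin.≟ i)
           ×-dec Fin.all? (λ i → g (f i) Fin.≟ i)
           ×-dec Fin.all? (λ i → Fin.all? λ j → adj G i j Bool.≟ adj H (f i) (f j))

    to : (∃[ c ] ∃[ d ] IsIso (finToFun c) (finToFun d)) → G ≅ H
    to (c , d , fg , gf , hom) = permutation (finToFun c) (finToFun d) fg gf , hom

    from : G ≅ H → ∃[ c ] ∃[ d ] IsIso (finToFun c) (finToFun d)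
    from (σ , hom) = funToFin f , funToFin g
      , (λ i → trans (f≗ _) (trans (cong f (g≗ i)) (inverseʳ σ)))
      , (λ i → trans (g≗ _) (trans (cong g (f≗ i)) (inverseˡ σ)))
      , (λ i j → trans (hom i j) (sym (cong₂ (adj H) (f≗ i) (f≗ j))))
      where
      f = σ ⟨$⟩ʳ_
      g = σ ⟨$⟩ˡ_
      f≗ = Fin.finToFun-funToFin f
      g≗ = Fin.finToFun-funToFin g

  ≈-isDecEquivalence : IsDecEquivalence _≈_
  ≈-isDecEquivalence = record
    { isEquivalence = record
      { refl  = λ i j → refl
      ; sym   = λ p i j → sym (p i j)
      ; trans = λ p q i j → trans (p i j) (q i j)
      }
    ; _≟_ = _≈?_
    }

  ≅-isDecEquivalence : IsDecEquivalence _≅_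
  ≅-isDecEquivalence = record
    { isEquivalence = record
      { refl  = id , λ i j → refl
      ; sym   = λ {G} {H} (σ , p) → flip σ , λ i j →
          trans (sym (cong₂ (adj H) (inverseʳ σ) (inverseʳ σ))) (sym (p _ _))
      ; trans = λ (σ , p) (τ , q) → σ ∘ₚ τ , λ i j → trans (p i j) (q _ _)
      }
    ; _≟_ = _≅?_
    }

  ≈⇒≅ : (G H : Graph n) → G ≈ H → G ≅ H
  ≈⇒≅ G H p = id , p

SplitGraph : ℕ → Set
SplitGraph n = Σ (Graph n) IsSplit

-- The clique in the second component is a mere witness: split graphs are
-- compared through the underlying graphs only.

LabeledSplit : ℕ → DecSetoid 0ℓ 0ℓ
LabeledSplit n = On.decSetoid {B = SplitGraph n}
  (record { isDecEquivalence = ≈-isDecEquivalence }) proj₁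

UnlabeledSplit : ℕ → DecSetoid 0ℓ 0ℓ
UnlabeledSplit n = On.decSetoid {B = SplitGraph n}
  (record { isDecEquivalence = ≅-isDecEquivalence }) proj₁

-- k is the number of equivalence classes of S.
HasCardinality : Setoid 0ℓ 0ℓ → ℕ → Set
HasCardinality S k = Bijection (≡.setoid (Fin k)) S

lookup-injective : (S : Setoid 0ℓ 0ℓ) (xs : List (Setoid.Carrier S)) → Unique S xs →
                   ∀ i j → Setoid._≈_ S (lookup xs i) (lookup xs j) → i ≡ j
lookup-injective S (x ∷ xs) (x# ∷ u) zero    zero    eq = refl
lookup-injective S (x ∷ xs) (x# ∷ u) zero    (suc j) eq =
  contradiction eq (All.lookup x# (∈-lookup j))
lookup-injective S (x ∷ xs) (x# ∷ u) (suc i) zero    eq =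
  contradiction (Setoid.sym S eq) (All.lookup x# (∈-lookup i))
lookup-injective S (x ∷ xs) (x# ∷ u) (suc i) (suc j) eq =
  cong suc (lookup-injective S xs u i j eq)

enumeration⇒cardinality : (D : DecSetoid 0ℓ 0ℓ) (xs : List (DecSetoid.Carrier D)) →
                          IsEnumeration (DecSetoid.setoid D) xs →
                          ∃[ k ] HasCardinality (DecSetoid.setoid D) k
enumeration⇒cardinality D xs enum = length ys , record
  { to        = lookup ys
  ; cong      = λ { refl → Setoid.refl S }
  ; bijective = (λ {i} {j} → lookup-injective S ys (deduplicate-! D xs) i j)
              , lookup-surjective S (deduplicate⁺ D enum)
  }
  where
  S  = DecSetoid.setoid D
  ys = deduplicate (DecSetoid._≟_ D) xs

module _ {n : ℕ} where

  -- Every Boolean matrix is turned into a graph by symmetrising it and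
  -- clearing its diagonal; every graph arises in this way.

  fromMatrix : (Fin n → Fin n → Bool) → Graph n
  fromMatrix M = record
    { adj    = λ i j → not (Dec.does (i Fin.≟ j)) ∧ (M i j ∨ M j i)
    ; symm   = λ i j → cong₂ _∧_ (cong not (does-sym i j)) (Bool.∨-comm (M i j) (M j i))
    ; irrefl = λ i → cong (λ b → not b ∧ (M i i ∨ M i i)) (Dec.dec-true (i Fin.≟ i) refl)
    }
    where
    does-sym : ∀ i j → Dec.does (i Fin.≟ j) ≡ Dec.does (j Fin.≟ i)
    does-sym i j = Dec.does-⇔ (mk⇔ sym sym)
      (i Fin.≟ j) (j Fin.≟ i)

  fromMatrix-adj : (G : Graph n) (M : Fin n → Fin n → Bool) →
                   (∀ i j → M i j ≡ adj G i j) → G ≈ fromMatrix M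
  fromMatrix-adj G M M≗ i j with i Fin.≟ j
  ... | yes refl = irrefl G i
  ... | no _     = sym (trans (cong₂ _∨_ (M≗ i j) (trans (M≗ j i) (symm G j i)))
                              (Bool.∨-idem (adj G i j)))

  bit : Fin 2 → Bool
  bit zero    = false
  bit (suc _) = true

  unbit : Bool → Fin 2
  unbit false = zero
  unbit true  = suc zero

  bit-unbit : ∀ b → bit (unbit b) ≡ b
  bit-unbit false = refl
  bit-unbit true  = refl

  decodeMatrix : Fin ((2 ^ n) ^ n) → Fin n → Fin n → Bool
  decodeMatrix c i j = bit (finToFun {2} {n} (finToFun {2 ^ n} {n} c i) j)

  encodeMatrix : (Fin n → Fin n → Bool) → Fin ((2 ^ n) ^ n)
  encodeMatrix M = funToFin λ i → funToFin λ j → unbit (M i j)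

  decode-encode : ∀ M i j → decodeMatrix (encodeMatrix M) i j ≡ M i j
  decode-encode M i j
    rewrite Fin.finToFun-funToFin {n} {2 ^ n} (λ i → funToFin λ j → unbit (M i j)) i
          | Fin.finToFun-funToFin {n} {2} (λ j → unbit (M i j)) j
    = bit-unbit (M i j)

  decode : Fin ((2 ^ n) ^ n) → Graph n
  decode c = fromMatrix (decodeMatrix c)

  decode-surjective : (G : Graph n) → ∃[ c ] G ≈ decode c
  decode-surjective G =
    encodeMatrix (adj G) , fromMatrix-adj G _ (decode-encode (adj G))

  asSplit : Graph n → Maybe (SplitGraph n)
  asSplit G with isSplit? G
  ... | yes p = just (G , p)
  ... | no  _ = nothing

  asSplit-just : (G : SplitGraph n) (H : Graph n) → proj₁ G ≈ H →
                 MAny.Any (λ H′ → proj₁ G ≈ proj₁ H′) (asSplit H)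
  asSplit-just (G , p) H G≈H with isSplit? H
  ... | yes _ = MAny.just G≈H
  ... | no ¬p = contradiction (isSplit-resp-≈ G H G≈H p) ¬p

  splitGraphs : List (SplitGraph n)
  splitGraphs = mapMaybe asSplit (map decode (allFin _))

  splitGraphs-complete : IsEnumeration (DecSetoid.setoid (LabeledSplit n)) splitGraphs
  splitGraphs-complete G with c , G≈c ← decode-surjective (proj₁ G) =
    Any.mapMaybe⁺ asSplit (map decode (allFin _))
      (Any.map⁺ (Any.map⁺ (Any.map (λ { refl → asSplit-just G (decode c) G≈c }) (∈-allFin c))))

labeledSplit-finite : ∀ n → ∃[ k ] HasCardinality (DecSetoid.setoid (LabeledSplit n)) k
labeledSplit-finite n = enumeration⇒cardinality (LabeledSplit n) splitGraphs splitGraphs-complete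

unlabeledSplit-finite : ∀ n → ∃[ k ] HasCardinality (DecSetoid.setoid (UnlabeledSplit n)) k
unlabeledSplit-finite n = enumeration⇒cardinality (UnlabeledSplit n) splitGraphs
  λ G → Any.map (λ {H} → ≈⇒≅ (proj₁ G) (proj₁ H)) (splitGraphs-complete G)

-- The numbers below are pinned down by the cardinality proofs they are
-- projected from (proj₂ of the same pairs); how they are computed is immaterial.

s : ℕ → ℕ
s n = proj₁ (labeledSplit-finite n)

s̃ : ℕ → ℕ
s̃ n = proj₁ (unlabeledSplit-finite n)

-- lim x n / y n = 1; the quotient need only be defined for all large n.

infix 4 _∼_

_∼_ : (ℕ → ℚ) → (ℕ → ℚ) → Set
x ∼ y = ∀ (ε : ℚ) → 0ℚ < ε → ∃[ N ] ∀ n → n ≥ N →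
        Σ[ y≢0 ∈ NonZero (y n) ] ∣ (x n ÷ y n) {{y≢0}} - 1ℚ ∣ < ε

{-# OPTIONS --safe #-}

-- By Burnside's lemma, s̃ n · n! counts the pairs (G , π) of a labeled split graph G and an
-- automorphism π of G.  The pairs with π = id contribute s n, so the other pairs have to be
-- shown to be few.  A split graph has at most (n + 1)² split partitions K ∪ S, and K ∪ S is a
-- partition of exactly 2^(|K||S|) graphs; hence it suffices to compare partition by partition.
-- If |K| and |S| both exceed 8v, then a permutation π moving m vertices moves at least 4vm
-- of the |K||S| pairs, and the adjacency of half of these is determined by that of the
-- remaining pairs when G is π-invariant.  So at most 2^(|K||S| - 2vm) graphs are π-invariant,
-- and summing over π ≠ id costs only a bounded factor, for v proportional to n.
-- The unbalanced partitions are negligible against a single balanced one.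

module Submission where

open import Defs
open import Data.Bool using (Bool; true; false; not; _∧_; _∨_; if_then_else_; T)
import Data.Bool.Properties as Bool
open import Data.Fin
  using (Fin; zero; suc; toℕ; combine; remQuot; quotient; remainder; finToFun; funToFin; splitAt; _↑ˡ_; _↑ʳ_)
open import Data.Fin.Permutation
  using (Permutation′; id; flip; _∘ₚ_; _⟨$⟩ʳ_; _⟨$⟩ˡ_; inverseˡ; inverseʳ; lift₀; lift₀-remove; remove; transpose)
import Data.Fin.Properties as Fin
open import Data.Fin.Subset using (_∈_; ∁)
open import Data.Fin.Subset.Properties using (x∈∁p⇒x∉p; x∉p⇒x∈∁p)
open import Data.Integer using (+_; +[1+_])
import Data.Integer as ℤ
import Data.Integer.Properties as ℤ
open import Data.Nat hiding (_/_; _%_)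
import Data.Nat as ℕ
open import Data.Nat.DivMod using (m≡m%n+[m/n]*n; m%n<n; m/n*n≤m; /-monoˡ-≤; m*n/n≡m)
open import Data.Nat.Induction using (<-wellFounded)
open import Data.Nat.Properties
open import Data.Nat.Solver using (module +-*-Solver)
open import Algebra.Properties.Semiring.Sum +-*-semiring
open import Data.Product using (∃-syntax; Σ-syntax; _×_; _,_; proj₁; proj₂; swap)
open import Data.Rational using (ℚ; mkℚ; 0ℚ; 1ℚ; _/_; ↧ₙ_; toℚᵘ)
import Data.Rational as ℚ
import Data.Rational.Properties as ℚ
open import Data.Rational.Unnormalised using (mkℚᵘ; *<*; *≤*)
import Data.Rational.Unnormalised as ℚᵘ
import Data.Rational.Unnormalised.Properties as ℚᵘ
open import Data.Sum using (_⊎_; inj₁; inj₂; [_,_]′)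
open import Data.Vec using (lookup; tabulate)
open import Data.Vec.Properties using (lookup⇒[]=; []=⇒lookup; lookup∘tabulate)
open import Function using (_∘_; const; case_of_; Bijection; Equivalence)
open import Function.Definitions using (Injective)
open import Induction.WellFounded using (Acc; acc)
open import Relation.Binary using (DecSetoid; IsDecEquivalence)
open import Relation.Binary.PropositionalEquality hiding ([_])
open import Relation.Nullary using (Dec; yes; no; ¬_; ¬?; contradiction; _×-dec_; _→-dec_; _⊎-dec_)
open import Relation.Nullary.Decidable using (dec-false; decidable-stable)
open import Relation.Unary using (Decidable)
open +-*-Solver using (solve; _:=_; _:*_; _:+_; con)

-- Counting

-- The saving 2^(2vm) is spent in two halves. One half pays for the choice of π: with N = 2^v a
-- permutation moving m vertices gets weight N^(-m), and these weights add up to at most (1 +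
-- n/N)^n, which is at most 2 once 2n² ≤ N. Since m ≥ 1, the other half is at least 2^v; it has to
-- beat the (n + 1)² partitions of a graph and a further factor n, which yields an error of order
-- 1/n. The obstacle is that π does not permute the pairs between K and S: it may carry such a pair
-- into one side. So the proof does not count cycles of π on pairs; it compares each pair with its
-- image in a fixed numbering. If the image is smaller, or lies inside one side, the pair is
-- determined. If the image is larger, it is determined by the original pair under π⁻¹, which leaves
-- the same graphs invariant. Hence π or π⁻¹ determines half of the moved pairs. A linear v makes
-- 2^v exceed every polynomial, while 64v ≤ n keeps unbalanced partitions, with at most 8vn pairs,
-- well below the 16vn pairs of a balanced one.

sum-mono-≤ : ∀ {n} {f g : Fin n → ℕ} → (∀ i → f i ≤ g i) → sum f ≤ sum g
sum-mono-≤ {zero}  f≤g = z≤n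
sum-mono-≤ {suc n} f≤g = +-mono-≤ (f≤g zero) (sum-mono-≤ (f≤g ∘ suc))

sum-const : ∀ n x → ∑[ i < n ] x ≡ n * x
sum-const zero    x = refl
sum-const (suc n) x = cong (x ℕ.+_) (sum-const n x)

sum-upper : ∀ {n} {f : Fin n → ℕ} {x} → (∀ i → f i ≤ x) → sum f ≤ n * x
sum-upper {n} {x = x} f≤x = ≤-trans (sum-mono-≤ f≤x) (≤-reflexive (sum-const n x))

term≤sum : ∀ {n} (f : Fin n → ℕ) i → f i ≤ sum f
term≤sum f zero    = m≤m+n _ _
term≤sum f (suc i) = ≤-trans (term≤sum (f ∘ suc) i) (m≤n+m _ _)

sum-++ : ∀ m {n} (f : Fin (m + n) → ℕ) →
         sum f ≡ ∑[ i < m ] f (i ↑ˡ n) + ∑[ j < n ] f (m ↑ʳ j)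
sum-++ zero    f = refl
sum-++ (suc m) f = trans (cong (f zero ℕ.+_) (sum-++ m (f ∘ suc))) (sym (+-assoc (f zero) _ _))

sum-combine : ∀ m n (f : Fin (m * n) → ℕ) → sum f ≡ ∑[ i < m ] ∑[ j < n ] f (combine i j)
sum-combine zero    n f = refl
sum-combine (suc m) n f =
  trans (sum-++ n f) (cong (∑[ j < n ] f (j ↑ˡ (m * n)) ℕ.+_) (sum-combine m n (f ∘ (n ↑ʳ_))))

-- The Iverson bracket: cardinalities become sums, and double counting becomes `∑-comm`.
⟦_⟧ : {A : Set} → Dec A → ℕ
⟦ yes _ ⟧ = 1
⟦ no _ ⟧  = 0

⟦⟧≤1 : {A : Set} (a? : Dec A) → ⟦ a? ⟧ ≤ 1
⟦⟧≤1 (yes _) = ≤-refl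
⟦⟧≤1 (no _)  = z≤n

⟦⟧-true : {A : Set} (a? : Dec A) → A → ⟦ a? ⟧ ≡ 1
⟦⟧-true (yes _) a = refl
⟦⟧-true (no ¬a) a = contradiction a ¬a

⟦⟧-false : {A : Set} (a? : Dec A) → ¬ A → ⟦ a? ⟧ ≡ 0
⟦⟧-false (yes a) ¬a = contradiction a ¬a
⟦⟧-false (no _)  ¬a = refl

⟦⟧-mono : {A B : Set} (a? : Dec A) (b? : Dec B) → (A → B) → ⟦ a? ⟧ ≤ ⟦ b? ⟧
⟦⟧-mono (no _)  b? f = z≤n
⟦⟧-mono (yes a) b? f = ≤-reflexive (sym (⟦⟧-true b? (f a)))

count : ∀ {n} {P : Fin n → Set} → Decidable P → ℕ
count P? = sum λ i → ⟦ P? i ⟧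

module _ {n : ℕ} {P : Fin n → Set} (P? : Decidable P) where

  count-≤ : count P? ≤ n
  count-≤ = ≤-trans (sum-upper (⟦⟧≤1 ∘ P?)) (≤-reflexive (*-identityʳ n))

  count-mono : {Q : Fin n → Set} (Q? : Decidable Q) → (∀ i → P i → Q i) → count P? ≤ count Q?
  count-mono Q? P⇒Q = sum-mono-≤ λ i → ⟦⟧-mono (P? i) (Q? i) (P⇒Q i)

-- With `rank` as its inverse, this lists the solutions of `P?` in increasing order, so that
-- inequalities between counts reduce to injections between `Fin` types.
select : ∀ {n} {P : Fin n → Set} (P? : Decidable P) → Fin (count P?) → Fin n
select {suc n} P? x with P? zero
select {suc n} P? zero    | yes _ = zero
select {suc n} P? (suc x) | yes _ = suc (select (P? ∘ suc) x)
select {suc n} P? x       | no _  = suc (select (P? ∘ suc) x)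

select-holds : ∀ {n} {P : Fin n → Set} (P? : Decidable P) x → P (select P? x)
select-holds {suc n} P? x with P? zero
select-holds {suc n} P? zero    | yes p = p
select-holds {suc n} P? (suc x) | yes _ = select-holds (P? ∘ suc) x
select-holds {suc n} P? x       | no _  = select-holds (P? ∘ suc) x

rank : ∀ {n} {P : Fin n → Set} (P? : Decidable P) i → P i → Fin (count P?)
rank {suc n} P? i pi with P? zero
rank {suc n} P? zero    pi | yes _ = zero
rank {suc n} P? (suc i) pi | yes _ = suc (rank (P? ∘ suc) i pi)
rank {suc n} P? zero    pi | no ¬p = contradiction pi ¬p
rank {suc n} P? (suc i) pi | no _  = rank (P? ∘ suc) i pi

select-rank : ∀ {n} {P : Fin n → Set} (P? : Decidable P) i (pi : P i) →
              select P? (rank P? i pi) ≡ i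
select-rank {suc n} P? i pi with P? zero
select-rank {suc n} P? zero    pi | yes _ = refl
select-rank {suc n} P? (suc i) pi | yes _ = cong suc (select-rank (P? ∘ suc) i pi)
select-rank {suc n} P? zero    pi | no ¬p = contradiction pi ¬p
select-rank {suc n} P? (suc i) pi | no _  = cong suc (select-rank (P? ∘ suc) i pi)

select-injective : ∀ {n} {P : Fin n → Set} (P? : Decidable P) → Injective _≡_ _≡_ (select P?)
select-injective {suc n} P? {x} {y} eq with P? zero
select-injective {suc n} P? {zero}  {zero}  eq | yes _ = refl
select-injective {suc n} P? {suc x} {suc y} eq | yes _ =
  cong suc (select-injective (P? ∘ suc) (Fin.suc-injective eq))
select-injective {suc n} P? {x} {y} eq | no _ =
  select-injective (P? ∘ suc) (Fin.suc-injective eq)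

module _ {n : ℕ} {P : Fin n → Set} (P? : Decidable P) where

  count-upper : ∀ {m} (f : Fin n → Fin m) →
                (∀ {i j} → P i → P j → f i ≡ f j → i ≡ j) → count P? ≤ m
  count-upper f inj = Fin.injective⇒≤ {f = f ∘ select P?} λ eq →
    select-injective P? (inj (select-holds P? _) (select-holds P? _) eq)

  count-lower : ∀ {m} (f : Fin m → Fin n) → Injective _≡_ _≡_ f → (∀ x → P (f x)) → m ≤ count P?
  count-lower f inj Pf = Fin.injective⇒≤ {f = λ x → rank P? (f x) (Pf x)} λ {x} {y} eq →
    inj (trans (sym (select-rank P? (f x) (Pf x)))
               (trans (cong (select P?) eq) (select-rank P? (f y) (Pf y))))

  count-inject : ∀ {m} {Q : Fin m → Set} (Q? : Decidable Q) (f : Fin n → Fin m) →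
                 (∀ {i} → P i → Q (f i)) →
                 (∀ {i j} → P i → P j → f i ≡ f j → i ≡ j) → count P? ≤ count Q?
  count-inject Q? f Qf inj = Fin.injective⇒≤
    {f = λ x → rank Q? (f (select P? x)) (Qf (select-holds P? x))} λ {x} {y} eq →
      select-injective P? (inj (select-holds P? x) (select-holds P? y)
        (trans (sym (select-rank Q? _ _)) (trans (cong (select Q?) eq) (select-rank Q? _ _))))

⟦⟧-× : {A B : Set} (a? : Dec A) (b? : Dec B) → ⟦ a? ×-dec b? ⟧ ≡ ⟦ a? ⟧ * ⟦ b? ⟧
⟦⟧-× (yes _) (yes _) = refl
⟦⟧-× (yes _) (no _)  = refl
⟦⟧-× (no _)  _       = refl

⟦⟧-split : {A B : Set} (a? : Dec A) (b? : Dec B) →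
           ⟦ a? ×-dec b? ⟧ + ⟦ a? ×-dec ¬? b? ⟧ ≡ ⟦ a? ⟧
⟦⟧-split (yes _) (yes _) = refl
⟦⟧-split (yes _) (no _)  = refl
⟦⟧-split (no _)  _       = refl

module _ {n : ℕ} {P Q : Fin n → Set} (P? : Decidable P) (Q? : Decidable Q) where

  count-split : count (λ i → P? i ×-dec Q? i) + count (λ i → P? i ×-dec ¬? (Q? i)) ≡ count P?
  count-split = trans (sym (∑-distrib-+ (λ i → ⟦ P? i ×-dec Q? i ⟧) _))
                      (sum-cong-≗ λ i → ⟦⟧-split (P? i) (Q? i))

count-≢ : ∀ {n} {P : Fin n → Set} (P? : Decidable P) k →
          count P? ≤ suc (count (λ i → P? i ×-dec ¬? (i Fin.≟ k)))
count-≢ {n} P? k = begin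
  count P?
    ≡⟨ count-split P? (Fin._≟ k) ⟨
  count (λ i → P? i ×-dec i Fin.≟ k) + count (λ i → P? i ×-dec ¬? (i Fin.≟ k))
    ≤⟨ +-monoˡ-≤ _ (count-upper (λ i → P? i ×-dec i Fin.≟ k) {1} (λ _ → zero)
         λ (_ , i≡k) (_ , j≡k) _ → trans i≡k (sym j≡k)) ⟩
  suc (count (λ i → P? i ×-dec ¬? (i Fin.≟ k))) ∎
  where open ≤-Reasoning

-- Codes a set with at most one element by one of n + 1 values; `zero` stands for the empty set.
locate : ∀ {n} {P : Fin n → Set} → Decidable P → Fin (suc n)
locate P? with Fin.any? P?
... | yes (i , _) = suc i
... | no _        = zero

locate-sound : ∀ {n} {P : Fin n → Set} (P? : Decidable P) {i} → locate P? ≡ suc i → P i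
locate-sound P? eq with Fin.any? P?
locate-sound P? refl | yes (i , p) = p

locate-complete : ∀ {n} {P : Fin n → Set} (P? : Decidable P) {i} →
                  (∀ {j k} → P j → P k → j ≡ k) → P i → locate P? ≡ suc i
locate-complete P? unique p with Fin.any? P?
... | yes (_ , q) = cong suc (unique q p)
... | no ¬p       = contradiction (_ , p) ¬p

-- Coding Boolean functions by numbers

funToFin-cong : ∀ {m n} {f g : Fin m → Fin n} → (∀ i → f i ≡ g i) → funToFin f ≡ funToFin g
funToFin-cong {zero}  eq = refl
funToFin-cong {suc m} eq = cong₂ combine (eq zero) (funToFin-cong (eq ∘ suc))

-- Without function extensionality Boolean functions cannot be counted up to `_≡_`; sums over vertex
-- partitions run over these codes instead.
bits : ∀ k → Fin (2 ^ k) → Fin k → Bool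
bits k c i = bit {k} (finToFun {2} {k} c i)

fromBits : ∀ {k} → (Fin k → Bool) → Fin (2 ^ k)
fromBits {k} f = funToFin (unbit {k} ∘ f)

bits-fromBits : ∀ {k} (f : Fin k → Bool) i → bits k (fromBits f) i ≡ f i
bits-fromBits {k} f i =
  trans (cong (bit {k}) (Fin.finToFun-funToFin (unbit {k} ∘ f) i)) (bit-unbit {k} (f i))

bits-injective : ∀ k {c d : Fin (2 ^ k)} → (∀ i → bits k c i ≡ bits k d i) → c ≡ d
bits-injective k {c} {d} eq = begin
  c                           ≡⟨ Fin.funToFin-finToFin {k} {2} c ⟨
  funToFin (finToFun {2} {k} c)   ≡⟨ funToFin-cong {k} {2} (λ i → bit-injective (eq i)) ⟩
  funToFin (finToFun {2} {k} d)   ≡⟨ Fin.funToFin-finToFin {k} {2} d ⟩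
  d                           ∎
  where
  open ≡-Reasoning
  bit-injective : ∀ {x y} → bit {k} x ≡ bit {k} y → x ≡ y
  bit-injective {zero}     {zero}     _ = refl
  bit-injective {suc zero} {suc zero} _ = refl

extendBy : ∀ {n} {P : Fin n → Set} (P? : Decidable P) → (Fin (count P?) → Bool) → Fin n → Bool
extendBy P? f i with P? i
... | yes p = f (rank P? i p)
... | no _  = false

extendBy-select : ∀ {n} {P : Fin n → Set} (P? : Decidable P) f x →
                  extendBy P? f (select P? x) ≡ f x
extendBy-select P? f x with P? (select P? x)
... | yes p = cong f (select-injective P? (select-rank P? (select P? x) p))
... | no ¬p = contradiction (select-holds P? x) ¬p

count₂-lower : ∀ {k m n} {P : Fin m → Fin n → Set} (P? : ∀ i j → Dec (P i j))
               (f : Fin k → Fin m) (g : Fin k → Fin n) →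
               (∀ {x y} → f x ≡ f y → g x ≡ g y → x ≡ y) → (∀ x → P (f x) (g x)) →
               k ≤ ∑[ i < m ] ∑[ j < n ] ⟦ P? i j ⟧
count₂-lower {k} {m} {n} {P} P? f g inj Pfg = begin
  k
    ≤⟨ count-lower Q? (λ x → combine (f x) (g x))
         (λ {x} {y} eq → let f≡ , g≡ = Fin.combine-injective (f x) (g x) (f y) (g y) eq in inj f≡ g≡)
         (λ x → subst Pair (sym (Fin.remQuot-combine (f x) (g x))) (Pfg x)) ⟩
  count Q?
    ≡⟨ sum-combine m n (λ x → ⟦ Q? x ⟧) ⟩
  ∑[ i < m ] ∑[ j < n ] ⟦ Q? (combine i j) ⟧
    ≡⟨ sum-cong-≗ (λ i → sum-cong-≗ λ j → cong (λ (x , y) → ⟦ P? x y ⟧) (Fin.remQuot-combine i j)) ⟩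
  ∑[ i < m ] ∑[ j < n ] ⟦ P? i j ⟧ ∎
  where
  open ≤-Reasoning
  Pair : Fin m × Fin n → Set
  Pair (i , j) = P i j
  Q? : Decidable (λ x → Pair (remQuot {m} n x))
  Q? x = P? (proj₁ (remQuot {m} n x)) (proj₂ (remQuot {m} n x))

-- Permutations

module _ {n : ℕ} (π : Permutation′ n) where

  ⟨$⟩ʳ-injective : Injective _≡_ _≡_ (π ⟨$⟩ʳ_)
  ⟨$⟩ʳ-injective eq = trans (sym (inverseˡ π)) (trans (cong (π ⟨$⟩ˡ_) eq) (inverseˡ π))

-- The transposition moves at most one successor, and it sends that one to zero; a successor that
-- lands on a successor has stayed in place.
transpose-fixed : ∀ {n} (j : Fin (suc n)) (k i : Fin n) →
                  transpose zero j ⟨$⟩ʳ suc k ≡ suc i → k ≡ i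
transpose-fixed zero    k i eq = Fin.suc-injective eq
transpose-fixed (suc j) k i eq with k Fin.≟ j
... | yes _ = contradiction eq λ ()
... | no _  = Fin.suc-injective eq

-- Inserting 0 by a transposition, rather than with Data.Fin.Permutation.insert, leaves no
-- new fixed points besides 0.
extend : ∀ {n} → Fin (suc n) → Permutation′ n → Permutation′ (suc n)
extend j π = lift₀ π ∘ₚ transpose zero j

-- A factorial number system whose leading digit is the image of zero.
perm : ∀ n → Fin (n !) → Permutation′ n
perm zero    c = id
perm (suc n) c = extend (proj₁ (remQuot {suc n} (n !) c)) (perm n (proj₂ (remQuot {suc n} (n !) c)))

perm-combine : ∀ n j c → perm (suc n) (combine j c) ≡ extend j (perm n c)
perm-combine n j c = cong (λ (x , y) → extend x (perm n y)) (Fin.remQuot-combine j c)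

extend-injective : ∀ {n} j k (π ρ : Permutation′ n) →
                   (∀ i → extend j π ⟨$⟩ʳ i ≡ extend k ρ ⟨$⟩ʳ i) →
                   j ≡ k × (∀ i → π ⟨$⟩ʳ i ≡ ρ ⟨$⟩ʳ i)
extend-injective j k π ρ eq with refl ← eq zero =
  refl , λ i → Fin.suc-injective (⟨$⟩ʳ-injective (transpose zero j) (eq (suc i)))

perm-injective : ∀ n {c d} → (∀ i → perm n c ⟨$⟩ʳ i ≡ perm n d ⟨$⟩ʳ i) → c ≡ d
perm-injective zero    {zero} {zero} _ = refl
perm-injective (suc n) {c} {d} eq
  with j , c′ , refl ← Fin.combine-surjective {suc n} {n !} c
     | k , d′ , refl ← Fin.combine-surjective {suc n} {n !} d
  with j≡k , eq′ ← extend-injective j k (perm n c′) (perm n d′) (λ i →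
    trans (cong (_⟨$⟩ʳ i) (sym (perm-combine n j c′)))
          (trans (eq i) (cong (_⟨$⟩ʳ i) (perm-combine n k d′))))
  = cong₂ combine j≡k (perm-injective n eq′)

-- Undoing the transposition of zero with its image under `σ` leaves a permutation that fixes zero,
-- and `remove` reduces it to n points.
perm-surjective : ∀ n (σ : Permutation′ n) → ∃[ c ] ∀ i → perm n c ⟨$⟩ʳ i ≡ σ ⟨$⟩ʳ i
perm-surjective zero    σ = zero , λ ()
perm-surjective (suc n) σ
  with c , eq ← perm-surjective n (remove zero (σ ∘ₚ flip (transpose zero (σ ⟨$⟩ʳ zero))))
  = combine j c , λ i → trans (cong (_⟨$⟩ʳ i) (perm-combine n j c)) (agree i)
  where
  j = σ ⟨$⟩ʳ zero
  τ = transpose zero j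
  ρ = σ ∘ₚ flip τ

  lift-agree : ∀ i → lift₀ (perm n c) ⟨$⟩ʳ i ≡ ρ ⟨$⟩ʳ i
  lift-agree i = trans (lift-cong i) (lift₀-remove ρ (inverseˡ τ) i)
    where
    lift-cong : ∀ i → lift₀ (perm n c) ⟨$⟩ʳ i ≡ lift₀ (remove zero ρ) ⟨$⟩ʳ i
    lift-cong zero    = refl
    lift-cong (suc i) = cong suc (eq i)

  agree : ∀ i → extend j (perm n c) ⟨$⟩ʳ i ≡ σ ⟨$⟩ʳ i
  agree i = trans (cong (τ ⟨$⟩ʳ_) (lift-agree i)) (inverseʳ τ)

-- Fixed points

Fixed? : ∀ {n} (π : Permutation′ n) → Decidable (λ i → π ⟨$⟩ʳ i ≡ i)
Fixed? π i = π ⟨$⟩ʳ i Fin.≟ i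

fixed : ∀ {n} → Permutation′ n → ℕ
fixed π = count (Fixed? π)

fixed-extend-zero : ∀ {n} (π : Permutation′ n) → fixed (extend zero π) ≤ suc (fixed π)
fixed-extend-zero π = +-mono-≤ (⟦⟧≤1 (Fixed? (extend zero π) zero))
  (sum-mono-≤ λ i → ⟦⟧-mono (Fixed? (extend zero π) (suc i)) (Fixed? π i)
    (transpose-fixed zero (π ⟨$⟩ʳ i) i))

fixed-extend-suc : ∀ {n} j (π : Permutation′ n) → fixed (extend (suc j) π) ≤ fixed π
fixed-extend-suc j π = +-mono-≤ (≤-reflexive (⟦⟧-false (Fixed? (extend (suc j) π) zero) λ ()))
  (sum-mono-≤ λ i → ⟦⟧-mono (Fixed? (extend (suc j) π) (suc i)) (Fixed? π i)
    (transpose-fixed (suc j) (π ⟨$⟩ʳ i) i))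

-- Among the n + 1 ways to extend a permutation of n points, only `j = zero` can create a fixed
-- point and costs a factor N; the n others create none. Each new point therefore multiplies the sum
-- by at most N + n, which bounds it by the rising factorial N(N + 1)⋯(N + n - 1).
∑-fixed : ∀ n N .{{_ : NonZero N}} → ∑[ c < n ! ] (N ^ fixed (perm n c)) ≤ (N + n) ^ n
∑-fixed zero    N = ≤-refl
∑-fixed (suc n) N = begin
  ∑[ c < suc n ! ] (N ^ fixed (perm (suc n) c))
    ≡⟨ sum-combine (suc n) (n !) _ ⟩
  ∑[ j < suc n ] ∑[ c < n ! ] (N ^ fixed (perm (suc n) (combine j c)))
    ≡⟨ sum-cong-≗ (λ j → sum-cong-≗ λ c → cong (λ π → N ^ fixed π) (perm-combine n j c)) ⟩
  ∑[ j < suc n ] ∑[ c < n ! ] (N ^ fixed (extend j (perm n c)))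
    ≤⟨ +-mono-≤ (sum-mono-≤ λ c → ^-monoʳ-≤ N (fixed-extend-zero (perm n c)))
                (sum-upper λ j → sum-mono-≤ λ c → ^-monoʳ-≤ N (fixed-extend-suc j (perm n c))) ⟩
  ∑[ c < n ! ] (N * N ^ fixed (perm n c)) + n * W
    ≡⟨ cong (_+ n * W) (sym (*-distribˡ-sum N (λ c → N ^ fixed (perm n c)))) ⟩
  N * W + n * W
    ≡⟨ *-distribʳ-+ W N n ⟨
  (N + n) * W
    ≤⟨ *-monoʳ-≤ (N + n) (≤-trans (∑-fixed n N) (^-monoˡ-≤ n (+-monoʳ-≤ N (n≤1+n n)))) ⟩
  (N + n) * (N + suc n) ^ n
    ≤⟨ *-monoˡ-≤ _ (+-monoʳ-≤ N (n≤1+n n)) ⟩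
  (N + suc n) ^ suc n ∎
  where
  open ≤-Reasoning
  W = ∑[ c < n ! ] (N ^ fixed (perm n c))

-- Burnside's counting argument

-- The Boolean `K i` serves both as the side of `i` and as the adjacency forced within that side, so
-- one equation covers the clique and the stable set.
SplitBy : ∀ {n} → (Fin n → Bool) → Graph n → Set
SplitBy K G = ∀ i j → i ≢ j → K i ≡ K j → adj G i j ≡ K i

module _ {n : ℕ} where

  splitBy? : ∀ K (G : Graph n) → Dec (SplitBy K G)
  splitBy? K G = Fin.all? λ i → Fin.all? λ j →
    ¬? (i Fin.≟ j) →-dec (K i Bool.≟ K j) →-dec (adj G i j Bool.≟ K i)

  isSplit⇒splitBy : (G : Graph n) → IsSplit G → ∃[ K ] SplitBy K G
  isSplit⇒splitBy G (K , clique , stable) = lookup K , λ i j → by i j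
    where
    outside : ∀ i → lookup K i ≡ false → i ∈ ∁ K
    outside i eq = x∉p⇒x∈∁p λ i∈K → contradiction (trans (sym ([]=⇒lookup i∈K)) eq) λ ()

    by : SplitBy (lookup K) G
    by i j i≢j eq with lookup K i in eqᵢ
    ... | true  = Equivalence.to Bool.T-≡ (clique i j (lookup⇒[]= i K eqᵢ) (lookup⇒[]= j K (sym eq)) i≢j)
    ... | false with adj G i j in eqₐ
    ...   | true  = contradiction (subst T (sym eqₐ) _)
                      (stable i j (outside i eqᵢ) (outside j (sym eq)))
    ...   | false = refl

  splitBy⇒isSplit : (G : Graph n) (K : Fin n → Bool) → SplitBy K G → IsSplit G
  splitBy⇒isSplit G K by = tabulate K
    , (λ i j i∈ j∈ i≢j → Equivalence.from Bool.T-≡ (trans (by i j i≢j (trans (inside i∈) (sym (inside j∈)))) (inside i∈)))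
    , stable
    where
    inside : ∀ {i} → i ∈ tabulate K → K i ≡ true
    inside {i} i∈ = trans (sym (lookup∘tabulate K i)) ([]=⇒lookup i∈)

    outside : ∀ {i} → i ∈ ∁ (tabulate K) → K i ≡ false
    outside {i} i∈ with K i in eq
    ... | false = refl
    ... | true  = contradiction (lookup⇒[]= i _ (trans (lookup∘tabulate K i) eq)) (x∈∁p⇒x∉p i∈)

    stable : IsStable G (∁ (tabulate K))
    stable i j i∈ j∈ e with i Fin.≟ j
    ... | yes refl = subst T (irrefl G i) e
    ... | no i≢j   = subst T (trans (by i j i≢j (trans (outside i∈) (sym (outside j∈)))) (outside i∈)) e

  relabel : Permutation′ n → Graph n → Graph n
  relabel π G = record
    { adj    = λ i j → adj G (π ⟨$⟩ˡ i) (π ⟨$⟩ˡ j)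
    ; symm   = λ i j → symm G _ _
    ; irrefl = λ i → irrefl G _
    }

  relabel-≅ : ∀ π (G : Graph n) → G ≅ relabel π G
  relabel-≅ π G = π , λ i j → sym (cong₂ (adj G) (inverseˡ π) (inverseˡ π))

  relabel-isSplit : ∀ π (G : Graph n) → IsSplit G → IsSplit (relabel π G)
  relabel-isSplit π G p with K , by ← isSplit⇒splitBy G p =
    splitBy⇒isSplit (relabel π G) (K ∘ (π ⟨$⟩ˡ_)) λ i j i≢j → by _ _ λ eq →
      i≢j (trans (sym (inverseʳ π)) (trans (cong (π ⟨$⟩ʳ_) eq) (inverseʳ π)))

  IsAut : Graph n → Permutation′ n → Set
  IsAut G π = ∀ i j → adj G i j ≡ adj G (π ⟨$⟩ʳ i) (π ⟨$⟩ʳ j)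

  isAut? : ∀ G π → Dec (IsAut G π)
  isAut? G π = Fin.all? λ i → Fin.all? λ j → adj G i j Bool.≟ adj G (π ⟨$⟩ʳ i) (π ⟨$⟩ʳ j)

  index : Permutation′ n → Fin (n !)
  index π = proj₁ (perm-surjective n π)

  perm-index : ∀ π i → perm n (index π) ⟨$⟩ʳ i ≡ π ⟨$⟩ʳ i
  perm-index π = proj₂ (perm-surjective n π)

module Labeled {n a : ℕ} (L : HasCardinality (DecSetoid.setoid (LabeledSplit n)) a) where

  graph : Fin a → Graph n
  graph g = proj₁ (Bijection.to L g)

  graph-isSplit : ∀ g → IsSplit (graph g)
  graph-isSplit g = proj₂ (Bijection.to L g)

  graph-injective : ∀ {g h} → graph g ≈ graph h → g ≡ h
  graph-injective = Bijection.injective L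

  graph-surjective : ∀ G → IsSplit G → ∃[ g ] graph g ≈ G
  graph-surjective G p with g , eq ← Bijection.surjective L (G , p) = g , eq refl

module Burnside {n a b : ℕ}
  (L : HasCardinality (DecSetoid.setoid (LabeledSplit n)) a)
  (U : HasCardinality (DecSetoid.setoid (UnlabeledSplit n)) b) where

  open Labeled L public
  private
    module ≅ = IsDecEquivalence (≅-isDecEquivalence {n})

    rep : Fin b → Graph n
    rep r = proj₁ (Bijection.to U r)

    orbit : ∀ g → ∃[ r ] rep r ≅ graph g
    orbit g with r , eq ← Bijection.surjective U (Bijection.to L g) = r , eq refl

    orb : Fin a → Fin b
    orb g = proj₁ (orbit g)

    ρ : Fin a → Permutation′ n
    ρ g = proj₁ (proj₂ (orbit g))

    ρ-iso : ∀ g i j → adj (rep (orb g)) i j ≡ adj (graph g) (ρ g ⟨$⟩ʳ i) (ρ g ⟨$⟩ʳ j)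
    ρ-iso g = proj₂ (proj₂ (orbit g))

    orb-unique : ∀ r g → rep r ≅ graph g → orb g ≡ r
    orb-unique r g iso = Bijection.injective U
      (≅.trans {i = rep (orb g)} {graph g} {rep r} (proj₂ (orbit g)) (≅.sym {rep r} {graph g} iso))

  -- A labeled graph is recovered from the representative of its orbit together with the chosen
  -- permutation that carries the representative to it.
  labeled≤unlabeled*! : a ≤ b * n !
  labeled≤unlabeled*! = Fin.injective⇒≤ {f = λ g → combine (orb g) (index (ρ g))} λ {g} {h} eq →
    let r≡ , c≡ = Fin.combine-injective (orb g) (index (ρ g)) (orb h) (index (ρ h)) eq
        ρ≗ : ∀ i → ρ g ⟨$⟩ʳ i ≡ ρ h ⟨$⟩ʳ i
        ρ≗ i = trans (sym (perm-index (ρ g) i))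
                 (trans (cong (λ c → perm n c ⟨$⟩ʳ i) c≡) (perm-index (ρ h) i))
        back : ∀ i → ρ h ⟨$⟩ʳ (ρ g ⟨$⟩ˡ i) ≡ i
        back i = trans (sym (ρ≗ _)) (inverseʳ (ρ g))
    in graph-injective λ i j → begin
      adj (graph g) i j
        ≡⟨ cong₂ (adj (graph g)) (inverseʳ (ρ g)) (inverseʳ (ρ g)) ⟨
      adj (graph g) (ρ g ⟨$⟩ʳ (ρ g ⟨$⟩ˡ i)) (ρ g ⟨$⟩ʳ (ρ g ⟨$⟩ˡ j))
        ≡⟨ ρ-iso g _ _ ⟨
      adj (rep (orb g)) (ρ g ⟨$⟩ˡ i) (ρ g ⟨$⟩ˡ j)
        ≡⟨ cong (λ r → adj (rep r) (ρ g ⟨$⟩ˡ i) (ρ g ⟨$⟩ˡ j)) r≡ ⟩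
      adj (rep (orb h)) (ρ g ⟨$⟩ˡ i) (ρ g ⟨$⟩ˡ j)
        ≡⟨ ρ-iso h _ _ ⟩
      adj (graph h) (ρ h ⟨$⟩ʳ (ρ g ⟨$⟩ˡ i)) (ρ h ⟨$⟩ʳ (ρ g ⟨$⟩ˡ j))
        ≡⟨ cong₂ (adj (graph h)) (back i) (back j) ⟩
      adj (graph h) i j ∎
    where open ≡-Reasoning

  -- The pair (representative of the orbit of g, π) is recovered from the image g of
  -- the representative under π together with the automorphism π ∘ (ρ g)⁻¹ of g.

  unlabeled*!≤automorphisms : b * n ! ≤ ∑[ g < a ] ∑[ c < n ! ] ⟦ isAut? (graph g) (perm n c) ⟧
  unlabeled*!≤automorphisms = count₂-lower (λ g c → isAut? (graph g) (perm n c))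
    gr (index ∘ aut) inj isAut
    where
    open ≡-Reasoning
    r : Fin (b * n !) → Fin b
    r x = proj₁ (remQuot {b} (n !) x)

    π : Fin (b * n !) → Permutation′ n
    π x = perm n (proj₂ (remQuot {b} (n !) x))

    found : ∀ x → ∃[ g ] graph g ≈ relabel (π x) (rep (r x))
    found x = graph-surjective (relabel (π x) (rep (r x)))
      (relabel-isSplit (π x) (rep (r x)) (proj₂ (Bijection.to U (r x))))

    gr : Fin (b * n !) → Fin a
    gr x = proj₁ (found x)

    aut : Fin (b * n !) → Permutation′ n
    aut x = flip (ρ (gr x)) ∘ₚ π x

    π-iso : ∀ x i j → adj (rep (r x)) i j ≡ adj (graph (gr x)) (π x ⟨$⟩ʳ i) (π x ⟨$⟩ʳ j)
    π-iso x i j = trans (proj₂ (relabel-≅ (π x) (rep (r x))) i j) (sym (proj₂ (found x) _ _))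

    orb-gr : ∀ x → orb (gr x) ≡ r x
    orb-gr x = orb-unique (r x) (gr x) (π x , π-iso x)

    isAut′ : ∀ x → IsAut (graph (gr x)) (aut x)
    isAut′ x i j = begin
      adj (graph g) i j
        ≡⟨ cong₂ (adj (graph g)) (inverseʳ (ρ g)) (inverseʳ (ρ g)) ⟨
      adj (graph g) (ρ g ⟨$⟩ʳ (ρ g ⟨$⟩ˡ i)) (ρ g ⟨$⟩ʳ (ρ g ⟨$⟩ˡ j))
        ≡⟨ ρ-iso g _ _ ⟨
      adj (rep (orb g)) (ρ g ⟨$⟩ˡ i) (ρ g ⟨$⟩ˡ j)
        ≡⟨ cong (λ r → adj (rep r) (ρ g ⟨$⟩ˡ i) (ρ g ⟨$⟩ˡ j)) (orb-gr x) ⟩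
      adj (rep (r x)) (ρ g ⟨$⟩ˡ i) (ρ g ⟨$⟩ˡ j)
        ≡⟨ π-iso x _ _ ⟩
      adj (graph g) (aut x ⟨$⟩ʳ i) (aut x ⟨$⟩ʳ j) ∎
      where g = gr x

    isAut : ∀ x → IsAut (graph (gr x)) (perm n (index (aut x)))
    isAut x i j = trans (isAut′ x i j)
      (sym (cong₂ (adj (graph (gr x))) (perm-index (aut x) i) (perm-index (aut x) j)))

    inj : ∀ {x y} → gr x ≡ gr y → index (aut x) ≡ index (aut y) → x ≡ y
    inj {x} {y} g≡ c≡ = begin
      x                                            ≡⟨ Fin.combine-remQuot {b} (n !) x ⟨
      combine (r x) (proj₂ (remQuot {b} (n !) x))  ≡⟨ cong₂ combine r≡ (perm-injective n π≗) ⟩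
      combine (r y) (proj₂ (remQuot {b} (n !) y))  ≡⟨ Fin.combine-remQuot {b} (n !) y ⟩
      y                                            ∎
      where
      r≡ : r x ≡ r y
      r≡ = trans (sym (orb-gr x)) (trans (cong orb g≡) (orb-gr y))

      aut≗ : ∀ i → aut x ⟨$⟩ʳ i ≡ aut y ⟨$⟩ʳ i
      aut≗ i = trans (sym (perm-index (aut x) i))
        (trans (cong (λ c → perm n c ⟨$⟩ʳ i) c≡) (perm-index (aut y) i))

      π≗ : ∀ i → π x ⟨$⟩ʳ i ≡ π y ⟨$⟩ʳ i
      π≗ i = begin
        π x ⟨$⟩ʳ i                      ≡⟨ cong (π x ⟨$⟩ʳ_) (inverseˡ (ρ (gr x))) ⟨
        aut x ⟨$⟩ʳ (ρ (gr x) ⟨$⟩ʳ i)    ≡⟨ aut≗ _ ⟩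
        aut y ⟨$⟩ʳ (ρ (gr x) ⟨$⟩ʳ i)    ≡⟨ cong (λ g → aut y ⟨$⟩ʳ (ρ g ⟨$⟩ʳ i)) g≡ ⟩
        aut y ⟨$⟩ʳ (ρ (gr y) ⟨$⟩ʳ i)    ≡⟨ cong (π y ⟨$⟩ʳ_) (inverseˡ (ρ (gr y))) ⟩
        π y ⟨$⟩ʳ i                      ∎

Nontrivial : ∀ {n} → Permutation′ n → Set
Nontrivial π = ∃[ i ] π ⟨$⟩ʳ i ≢ i

nontrivial? : ∀ {n} (π : Permutation′ n) → Dec (Nontrivial π)
nontrivial? π = Fin.any? λ i → ¬? (π ⟨$⟩ʳ i Fin.≟ i)

count-trivial : ∀ n → ∑[ c < n ! ] ⟦ ¬? (nontrivial? (perm n c)) ⟧ ≤ 1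
count-trivial n = count-upper (λ c → ¬? (nontrivial? (perm n c))) {1} (λ _ → zero) λ {c} {d} tc td _ →
  perm-injective n λ i → trans (trivial tc i) (sym (trivial td i))
  where
  trivial : ∀ {c} → ¬ Nontrivial (perm n c) → ∀ i → perm n c ⟨$⟩ʳ i ≡ i
  trivial {c} ¬nt i with perm n c ⟨$⟩ʳ i Fin.≟ i
  ... | yes eq = eq
  ... | no neq = contradiction (i , neq) ¬nt

-- Split partitions

splitBy-resp : ∀ {n} {K K′ : Fin n → Bool} (G : Graph n) → (∀ i → K i ≡ K′ i) → SplitBy K G → SplitBy K′ G
splitBy-resp G K≗ by i j i≢j eq =
  trans (by i j i≢j (trans (K≗ i) (trans eq (sym (K≗ j))))) (K≗ i)

partitions : ∀ {n} → Graph n → ℕ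
partitions {n} G = count λ (c : Fin (2 ^ n)) → splitBy? (bits n c) G

partitions≥1 : ∀ {n} (G : Graph n) → IsSplit G → 1 ≤ partitions G
partitions≥1 {n} G p with K , by ← isSplit⇒splitBy G p =
  ≤-trans (≤-reflexive (sym (⟦⟧-true (splitBy? (bits n c) G) by′))) (term≤sum (λ c → ⟦ splitBy? (bits n c) G ⟧) c)
  where
  c : Fin (2 ^ n)
  c = fromBits K
  by′ : SplitBy (bits n c) G
  by′ = splitBy-resp G (λ i → sym (bits-fromBits K i)) by

-- A clique and a stable set share at most one vertex, so two partitions differ
-- in at most one vertex in either direction.

partitions-≤ : ∀ {n} (G : Graph n) → IsSplit G → partitions G ≤ suc n * suc n
partitions-≤ {n} G p with K₀ , by₀ ← isSplit⇒splitBy G p =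
  -- A partition is coded by the vertex leaving the clique side of `K₀` and the vertex leaving its
  -- stable side; either may be absent, hence n + 1 values for each.
  count-upper (λ c → splitBy? (bits n c) G) (λ c → combine (locate (Moved? c true)) (locate (Moved? c false)))
    λ {c} {d} by-c by-d eq →
      let eqₜ , eq_f = Fin.combine-injective (locate (Moved? c true)) (locate (Moved? c false)) _ _ eq
      in bits-injective n λ i → same c d by-c by-d i (K₀ i) refl (locates c d eqₜ eq_f (K₀ i))
  where
  Moved : Fin (2 ^ n) → Bool → Fin n → Set
  Moved c b i = K₀ i ≡ b × bits n c i ≡ not b

  Moved? : ∀ c b → Decidable (Moved c b)
  Moved? c b i = (K₀ i Bool.≟ b) ×-dec (bits n c i Bool.≟ not b)

  unique : ∀ c b → SplitBy (bits n c) G → ∀ {i j} → Moved c b i → Moved c b j → i ≡ j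
  unique c b by {i} {j} (i₀ , iᶜ) (j₀ , jᶜ) with i Fin.≟ j
  ... | yes i≡j = i≡j
  ... | no i≢j  = contradiction
    (trans (sym (trans (by₀ i j i≢j (trans i₀ (sym j₀))) i₀))
           (trans (by i j i≢j (trans iᶜ (sym jᶜ))) iᶜ))
    (Bool.not-¬ refl)

  locates : ∀ c d → locate (Moved? c true) ≡ locate (Moved? d true) →
            locate (Moved? c false) ≡ locate (Moved? d false) →
            ∀ b → locate (Moved? c b) ≡ locate (Moved? d b)
  locates c d eqₜ eq_f true  = eqₜ
  locates c d eqₜ eq_f false = eq_f

  transfer : ∀ c d b → SplitBy (bits n c) G → locate (Moved? c b) ≡ locate (Moved? d b) →
             ∀ {i} → Moved c b i → Moved d b i
  transfer c d b by eq m = locate-sound (Moved? d b)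
    (trans (sym eq) (locate-complete (Moved? c b) (unique c b by) m))

  same : ∀ c d → SplitBy (bits n c) G → SplitBy (bits n d) G → ∀ i b → K₀ i ≡ b →
         locate (Moved? c b) ≡ locate (Moved? d b) → bits n c i ≡ bits n d i
  same c d by-c by-d i b i₀ eq with bits n c i Bool.≟ not b | bits n d i Bool.≟ not b
  ... | yes x | _     = trans x (sym (proj₂ (transfer c d b by-c eq (i₀ , x))))
  ... | no _  | yes y = trans (proj₂ (transfer d c b by-d (sym eq) (i₀ , y))) (sym y)
  ... | no x  | no y  = trans (Bool.¬-not x) (sym (Bool.¬-not y))

-- Pairs between the two sides

size : ∀ {n} → (Fin n → Bool) → Bool → ℕ
size K b = count λ i → K i Bool.≟ b

module _ {n : ℕ} where

  row col : Fin (n * n) → Fin n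
  row = quotient n
  col = remainder {n} n

  row-combine : ∀ i j → row (combine i j) ≡ i
  row-combine i j = cong proj₁ (Fin.remQuot-combine i j)

  col-combine : ∀ i j → col (combine i j) ≡ j
  col-combine i j = cong proj₂ (Fin.remQuot-combine {n} i j)

  -- Putting the clique vertex first gives each unordered pair between the sides exactly one
  -- position in the n × n table.
  Crossing : (Fin n → Bool) → Fin (n * n) → Set
  Crossing K x = K (row x) ≡ true × K (col x) ≡ false

  crossing? : ∀ K → Decidable (Crossing K)
  crossing? K x = (K (row x) Bool.≟ true) ×-dec (K (col x) Bool.≟ false)

  crossings : (Fin n → Bool) → ℕ
  crossings K = count (crossing? K)

  crossings-size : ∀ K → crossings K ≡ size K true * size K false
  crossings-size K = begin
    crossings K
      ≡⟨ sum-combine n n (λ x → ⟦ crossing? K x ⟧) ⟩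
    ∑[ i < n ] ∑[ j < n ] ⟦ crossing? K (combine i j) ⟧
      ≡⟨ sum-cong-≗ (λ i → sum-cong-≗ λ j → trans
           (cong₂ (λ a b → ⟦ (K a Bool.≟ true) ×-dec (K b Bool.≟ false) ⟧) (row-combine i j) (col-combine i j))
           (⟦⟧-× (K i Bool.≟ true) (K j Bool.≟ false))) ⟩
    ∑[ i < n ] ∑[ j < n ] (⟦ K i Bool.≟ true ⟧ * ⟦ K j Bool.≟ false ⟧)
      ≡⟨ sum-cong-≗ (λ i → sym (*-distribˡ-sum ⟦ K i Bool.≟ true ⟧ (λ j → ⟦ K j Bool.≟ false ⟧))) ⟩
    ∑[ i < n ] (⟦ K i Bool.≟ true ⟧ * size K false)
      ≡⟨ *-distribʳ-sum (size K false) (λ i → ⟦ K i Bool.≟ true ⟧) ⟨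
    size K true * size K false ∎
    where open ≡-Reasoning

  -- `fromMatrix` joins the entries at (i , j) and (j , i) by `_∨_`. The guard `K i` silences the
  -- entry whose row is a stable vertex, so `B` is read only at the oriented crossings.
  bipartite : (K : Fin n → Bool) (B : Fin (n * n) → Bool) → Graph n
  bipartite K B = fromMatrix λ i j → K i ∧ (K j ∨ B (combine i j))

  bipartite-splitBy : ∀ K B → SplitBy K (bipartite K B)
  bipartite-splitBy K B i j i≢j eq rewrite dec-false (i Fin.≟ j) i≢j with K i | K j
  bipartite-splitBy K B i j i≢j refl | true  | .true  = refl
  bipartite-splitBy K B i j i≢j refl | false | .false = refl

  bipartite-crossing : ∀ K B x → Crossing K x → adj (bipartite K B) (row x) (col x) ≡ B x
  bipartite-crossing K B x (r , c)
    rewrite dec-false (row x Fin.≟ col x) (λ eq → contradiction (trans (sym r) (trans (cong K eq) c)) λ ())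
          | r | c | Bool.∨-identityʳ (B (combine (row x) (col x)))
    = cong B (Fin.combine-remQuot {n} n x)

  module _ {a : ℕ} (L : HasCardinality (DecSetoid.setoid (LabeledSplit n)) a) where
    open Labeled L

    -- The bits at the crossings can be prescribed freely and read back from the adjacency.
    splitBy-count : ∀ K → 2 ^ crossings K ≤ ∑[ g < a ] ⟦ splitBy? K (graph g) ⟧
    splitBy-count K = count-lower (λ g → splitBy? K (graph g)) (proj₁ ∘ found)
      (λ {c} {d} eq → bits-injective (crossings K) λ x → begin
        bits (crossings K) c x                                             ≡⟨ read c x ⟨
        adj (graph (proj₁ (found c))) (row (pos x)) (col (pos x)) ≡⟨ cong (λ g → adj (graph g) (row (pos x)) (col (pos x))) eq ⟩
        adj (graph (proj₁ (found d))) (row (pos x)) (col (pos x)) ≡⟨ read d x ⟩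
        bits (crossings K) d x                                             ∎)
      (λ c i j i≢j eq → trans (proj₂ (found c) i j) (bipartite-splitBy K (B c) i j i≢j eq))
      where
      open ≡-Reasoning
      B : Fin (2 ^ crossings K) → Fin (n * n) → Bool
      B c = extendBy (crossing? K) (bits (crossings K) c)

      found : ∀ c → ∃[ g ] graph g ≈ bipartite K (B c)
      found c = graph-surjective (bipartite K (B c))
        (splitBy⇒isSplit (bipartite K (B c)) K (bipartite-splitBy K (B c)))

      pos : Fin (crossings K) → Fin (n * n)
      pos = select (crossing? K)

      read : ∀ c x → adj (graph (proj₁ (found c))) (row (pos x)) (col (pos x)) ≡ bits (crossings K) c x
      read c x = trans (proj₂ (found c) _ _)
        (trans (bipartite-crossing K (B c) (pos x) (select-holds (crossing? K) x))
               (extendBy-select (crossing? K) (bits (crossings K) c) x))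

-- Graphs invariant under a permutation

private
  double-support : ∀ v a b → 2 * (2 * (2 * v * (a + b))) ≡ a * (8 * v) + b * (8 * v)
  double-support = solve 3 (λ v a b → con 2 :* (con 2 :* (con 2 :* v :* (a :+ b)))
                              := a :* (con 8 :* v) :+ b :* (con 8 :* v)) refl

  support-exponent : ∀ v m f → v * m + v * (m + f) ≡ 2 * v * m + v * f
  support-exponent = solve 3 (λ v m f → v :* m :+ v :* (m :+ f) := con 2 :* v :* m :+ v :* f) refl

module _ {n : ℕ} (K : Fin n → Bool) where

  at : Graph n → Fin (n * n) → Bool
  at G x = adj G (row x) (col x)

  -- The action of π on the unordered pairs {row x, col x}, oriented so that pairs
  -- between the two sides are mapped to (clique vertex, stable vertex).
  act : Permutation′ n → Fin (n * n) → Fin (n * n)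
  act π x = if K i then combine i j else combine j i
    where
    i = π ⟨$⟩ʳ row x
    j = π ⟨$⟩ʳ col x

  -- For a π-invariant graph split by K, the adjacency at such a crossing x is determined
  -- by K and the adjacency at smaller crossings.
  Determined : Permutation′ n → Fin (n * n) → Set
  Determined π x = ¬ Crossing K (act π x) ⊎ toℕ (act π x) < toℕ x

  determined? : ∀ π → Decidable (Determined π)
  determined? π x = ¬? (crossing? K (act π x)) ⊎-dec (toℕ (act π x) <? toℕ x)

  free? : ∀ π → Decidable (λ x → Crossing K x × ¬ Determined π x)
  free? π x = crossing? K x ×-dec ¬? (determined? π x)

  at-act : ∀ π G → IsAut G π → ∀ x → at G x ≡ at G (act π x)
  at-act π G aut x with K (π ⟨$⟩ʳ row x)
  ... | true  = trans (aut _ _) (sym (cong₂ (adj G) (row-combine _ _) (col-combine _ _)))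
  ... | false = trans (aut _ _) (trans (symm G _ _)
                  (sym (cong₂ (adj G) (row-combine _ _) (col-combine _ _))))

  -- If the images of the two ends lay on different sides, `act` would have oriented them into a
  -- crossing.
  act-inside : ∀ π x → ¬ Crossing K (act π x) → K (π ⟨$⟩ʳ row x) ≡ K (π ⟨$⟩ʳ col x)
  act-inside π x ¬cr with K (π ⟨$⟩ʳ row x) in eqᵢ | K (π ⟨$⟩ʳ col x) in eqⱼ
  ... | true  | true  = refl
  ... | false | false = refl
  ... | true  | false = contradiction
    (trans (cong K (row-combine _ _)) eqᵢ , trans (cong K (col-combine _ _)) eqⱼ) ¬cr
  ... | false | true  = contradiction
    (trans (cong K (row-combine _ _)) eqⱼ , trans (cong K (col-combine _ _)) eqᵢ) ¬cr

  module _ (π : Permutation′ n) (G H : Graph n)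
    (byG : SplitBy K G) (byH : SplitBy K H) (autG : IsAut G π) (autH : IsAut H π)
    (agree : ∀ x → Crossing K x → ¬ Determined π x → at G x ≡ at H x) where

    private
      inside : ∀ x → Crossing K x → ¬ Crossing K (act π x) → at G x ≡ at H x
      inside x (r , c) ¬cr = begin
        at G x                                        ≡⟨ autG _ _ ⟩
        adj G (π ⟨$⟩ʳ row x) (π ⟨$⟩ʳ col x)           ≡⟨ byG _ _ distinct (act-inside π x ¬cr) ⟩
        K (π ⟨$⟩ʳ row x)                              ≡⟨ byH _ _ distinct (act-inside π x ¬cr) ⟨
        adj H (π ⟨$⟩ʳ row x) (π ⟨$⟩ʳ col x)           ≡⟨ autH _ _ ⟨
        at H x                                        ∎
        where
        open ≡-Reasoning
        distinct : π ⟨$⟩ʳ row x ≢ π ⟨$⟩ʳ col x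
        distinct eq = contradiction (trans (sym r) (trans (cong K (⟨$⟩ʳ-injective π eq)) c)) λ ()

      -- Descent in the numbering: following `act π` while it decreases ends at a free crossing,
      -- where the graphs agree by assumption, or at a pair inside one side, where `K` dictates the
      -- adjacency.
      crossing-agree : ∀ x → Acc _<_ (toℕ x) → Crossing K x → at G x ≡ at H x
      crossing-agree x (acc rec) cr with determined? π x | crossing? K (act π x)
      ... | no ¬det           | _       = agree x cr ¬det
      ... | yes (inj₁ ¬cr′)   | _       = inside x cr ¬cr′
      ... | yes (inj₂ act<x)  | no ¬cr′ = inside x cr ¬cr′
      ... | yes (inj₂ act<x)  | yes cr′ = trans (at-act π G autG x)
        (trans (crossing-agree (act π x) (rec act<x) cr′) (sym (at-act π H autH x)))

      cross : ∀ i j → K i ≡ true → K j ≡ false → adj G i j ≡ adj H i j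
      cross i j Ki Kj = begin
        adj G i j             ≡⟨ cong₂ (adj G) (row-combine i j) (col-combine i j) ⟨
        at G (combine i j)    ≡⟨ crossing-agree (combine i j) (<-wellFounded _)
                                   (trans (cong K (row-combine i j)) Ki , trans (cong K (col-combine i j)) Kj) ⟩
        at H (combine i j)    ≡⟨ cong₂ (adj H) (row-combine i j) (col-combine i j) ⟩
        adj H i j             ∎
        where open ≡-Reasoning

    free-determines : G ≈ H
    free-determines i j with i Fin.≟ j
    ... | yes refl = trans (irrefl G i) (sym (irrefl H i))
    ... | no i≢j with K i Bool.≟ K j
    ...   | yes eq = trans (byG i j i≢j eq) (sym (byH i j i≢j eq))
    ...   | no neq with K i in eqᵢ | K j in eqⱼ
    ...     | true  | true  = contradiction refl neq
    ...     | false | false = contradiction refl neq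
    ...     | true  | false = cross i j eqᵢ eqⱼ
    ...     | false | true  = trans (symm G i j) (trans (cross j i eqⱼ eqᵢ) (symm H j i))

  -- Once `π` is undone, `K` recognises the clique end of `x`, so the orientation is restored even
  -- if `act π` had exchanged the two ends.
  act-inverse : ∀ π x → Crossing K x → Crossing K (act π x) → act (flip π) (act π x) ≡ x
  act-inverse π x (r , c) (r′ , c′) with K (π ⟨$⟩ʳ row x)
  ... | true
    rewrite row-combine (π ⟨$⟩ʳ row x) (π ⟨$⟩ʳ col x) | col-combine (π ⟨$⟩ʳ row x) (π ⟨$⟩ʳ col x)
          | inverseˡ π {row x} | inverseˡ π {col x} | r = Fin.combine-remQuot {n} n x
  ... | false
    rewrite row-combine (π ⟨$⟩ʳ col x) (π ⟨$⟩ʳ row x) | col-combine (π ⟨$⟩ʳ col x) (π ⟨$⟩ʳ row x)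
          | inverseˡ π {row x} | inverseˡ π {col x} | c = Fin.combine-remQuot {n} n x

  moved? : ∀ π → Decidable (λ x → Crossing K x × act π x ≢ x)
  moved? π x = crossing? K x ×-dec ¬? (act π x Fin.≟ x)

  determined : Permutation′ n → ℕ
  determined π = count λ x → crossing? K x ×-dec determined? π x

  -- Of a moved crossing and its image, the larger one is determined by the smaller one
  -- (under π or under its inverse).
  moved≤determined : ∀ π → count (moved? π) ≤ determined π + determined (flip π)
  moved≤determined π = begin
    count (moved? π)
      ≡⟨ count-split (moved? π) (determined? π) ⟨
    count (λ x → moved? π x ×-dec determined? π x) + count (λ x → moved? π x ×-dec ¬? (determined? π x))
      ≤⟨ +-mono-≤
           (count-mono (λ x → moved? π x ×-dec determined? π x) (λ x → crossing? K x ×-dec determined? π x)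
             λ x ((cr , _) , det) → cr , det)
           (count-inject (λ x → moved? π x ×-dec ¬? (determined? π x))
             (λ x → crossing? K x ×-dec determined? (flip π) x) (act π) image
             λ {x} {y} p q eq → trans (sym (back p)) (trans (cong (act (flip π)) eq) (back q))) ⟩
    determined π + determined (flip π) ∎
    where
    open ≤-Reasoning
    cross′ : ∀ {x} → ¬ Determined π x → Crossing K (act π x)
    cross′ {x} ¬det = decidable-stable (crossing? K (act π x)) (¬det ∘ inj₁)

    back : ∀ {x} → ((Crossing K x × act π x ≢ x) × ¬ Determined π x) → act (flip π) (act π x) ≡ x
    back {x} ((cr , _) , ¬det) = act-inverse π x cr (cross′ ¬det)

    image : ∀ {x} → ((Crossing K x × act π x ≢ x) × ¬ Determined π x) →
            Crossing K (act π x) × Determined (flip π) (act π x)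
    image {x} p@((cr , moved) , ¬det) = cross′ ¬det , inj₂
      (subst (λ y → toℕ y < toℕ (act π x)) (sym (back p))
        (≤∧≢⇒< (≮⇒≥ (¬det ∘ inj₂)) (λ eq → moved (sym (Fin.toℕ-injective eq)))))

  act-fixed : ∀ π i j → act π (combine i j) ≡ combine i j →
              π ⟨$⟩ʳ i ≡ i × π ⟨$⟩ʳ j ≡ j ⊎ π ⟨$⟩ʳ i ≡ j × π ⟨$⟩ʳ j ≡ i
  act-fixed π i j eq rewrite row-combine i j | col-combine i j with K (π ⟨$⟩ʳ i)
  ... | true  = inj₁ (Fin.combine-injective _ _ i j eq)
  ... | false = inj₂ (swap (Fin.combine-injective _ _ i j eq))

  -- Moved vertices and moved pairs

  movedIn? : ∀ π b → Decidable (λ i → K i ≡ b × π ⟨$⟩ʳ i ≢ i)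
  movedIn? π b i = (K i Bool.≟ b) ×-dec ¬? (π ⟨$⟩ʳ i Fin.≟ i)

  movedIn : Permutation′ n → Bool → ℕ
  movedIn π b = count (movedIn? π b)

  private
    -- A pair with a moved end `i` is fixed only if `π` exchanges its ends. Excluding the partner
    -- `π ⟨$⟩ʳ i` rules this out and costs at most one vertex of the other side, whence `suc t`.
    count-pairs : ∀ {t} b b′ π → suc t ≤ size K b′ →
      movedIn π b * t ≤ ∑[ i < n ] ∑[ j < n ] ⟦ movedIn? π b i ×-dec ((K j Bool.≟ b′) ×-dec ¬? (j Fin.≟ π ⟨$⟩ʳ i)) ⟧
    count-pairs {t} b b′ π t<size = begin
      movedIn π b * t
        ≡⟨ *-distribʳ-sum t (λ i → ⟦ movedIn? π b i ⟧) ⟩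
      ∑[ i < n ] (⟦ movedIn? π b i ⟧ * t)
        ≤⟨ sum-mono-≤ (λ i → *-monoʳ-≤ ⟦ movedIn? π b i ⟧
             (s≤s⁻¹ (≤-trans t<size (count-≢ (λ j → K j Bool.≟ b′) (π ⟨$⟩ʳ i))))) ⟩
      ∑[ i < n ] (⟦ movedIn? π b i ⟧ * ∑[ j < n ] ⟦ other? i j ⟧)
        ≡⟨ sum-cong-≗ (λ i → trans (*-distribˡ-sum ⟦ movedIn? π b i ⟧ (λ j → ⟦ other? i j ⟧))
             (sum-cong-≗ λ j → sym (⟦⟧-× (movedIn? π b i) (other? i j)))) ⟩
      ∑[ i < n ] ∑[ j < n ] ⟦ movedIn? π b i ×-dec other? i j ⟧ ∎
      where
      open ≤-Reasoning
      other? : ∀ i j → Dec (K j ≡ b′ × j ≢ π ⟨$⟩ʳ i)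
      other? i j = (K j Bool.≟ b′) ×-dec ¬? (j Fin.≟ π ⟨$⟩ʳ i)

    moved-sum : ∀ π → count (moved? π) ≡ ∑[ i < n ] ∑[ j < n ] ⟦ moved? π (combine i j) ⟧
    moved-sum π = sum-combine n n (λ x → ⟦ moved? π x ⟧)

  movedIn-clique : ∀ {t} π → suc t ≤ size K false → movedIn π true * t ≤ count (moved? π)
  movedIn-clique π t< = ≤-trans (count-pairs true false π t<) (≤-trans
    (sum-mono-≤ λ i → sum-mono-≤ λ j → ⟦⟧-mono (movedIn? π true i ×-dec _) (moved? π (combine i j)) (imp i j))
    (≤-reflexive (sym (moved-sum π))))
    where
    imp : ∀ i j → (K i ≡ true × π ⟨$⟩ʳ i ≢ i) × (K j ≡ false × j ≢ π ⟨$⟩ʳ i) →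
          Crossing K (combine i j) × act π (combine i j) ≢ combine i j
    imp i j ((Ki , πi≢i) , (Kj , j≢πi)) =
      (trans (cong K (row-combine i j)) Ki , trans (cong K (col-combine i j)) Kj) ,
      λ eq → case act-fixed π i j eq of λ where
        (inj₁ (πi≡i , _)) → πi≢i πi≡i
        (inj₂ (πi≡j , _)) → j≢πi (sym πi≡j)

  movedIn-stable : ∀ {t} π → suc t ≤ size K true → movedIn π false * t ≤ count (moved? π)
  movedIn-stable π t< = ≤-trans (count-pairs false true π t<) (≤-trans
    (sum-mono-≤ λ j → sum-mono-≤ λ i → ⟦⟧-mono (movedIn? π false j ×-dec _) (moved? π (combine i j)) (imp i j))
    (≤-reflexive (trans (∑-comm {n} {n} (λ j i → ⟦ moved? π (combine i j) ⟧)) (sym (moved-sum π)))))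
    where
    imp : ∀ i j → (K j ≡ false × π ⟨$⟩ʳ j ≢ j) × (K i ≡ true × i ≢ π ⟨$⟩ʳ j) →
          Crossing K (combine i j) × act π (combine i j) ≢ combine i j
    imp i j ((Kj , πj≢j) , (Ki , i≢πj)) =
      (trans (cong K (row-combine i j)) Ki , trans (cong K (col-combine i j)) Kj) ,
      λ eq → case act-fixed π i j eq of λ where
        (inj₁ (_ , πj≡j)) → πj≢j πj≡j
        (inj₂ (_ , πj≡i)) → i≢πj (sym πj≡i)

  movedIn-sum : ∀ π → movedIn π true + movedIn π false + fixed π ≡ n
  movedIn-sum π = begin
    movedIn π true + movedIn π false + fixed π
      ≡⟨ cong (_+ fixed π) (∑-distrib-+ (λ i → ⟦ movedIn? π true i ⟧) _) ⟨
    ∑[ i < n ] (⟦ movedIn? π true i ⟧ + ⟦ movedIn? π false i ⟧) + fixed π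
      ≡⟨ ∑-distrib-+ (λ i → ⟦ movedIn? π true i ⟧ + ⟦ movedIn? π false i ⟧) (λ i → ⟦ Fixed? π i ⟧) ⟨
    ∑[ i < n ] (⟦ movedIn? π true i ⟧ + ⟦ movedIn? π false i ⟧ + ⟦ Fixed? π i ⟧)
      ≡⟨ sum-cong-≗ (λ i → one (K i) (Fixed? π i)) ⟩
    ∑[ i < n ] 1
      ≡⟨ trans (sum-const n 1) (*-identityʳ n) ⟩
    n ∎
    where
    open ≡-Reasoning
    one : ∀ b {A : Set} (a? : Dec A) →
          ⟦ (b Bool.≟ true) ×-dec ¬? a? ⟧ + ⟦ (b Bool.≟ false) ×-dec ¬? a? ⟧ + ⟦ a? ⟧ ≡ 1
    one true  (yes _) = refl
    one true  (no _)  = refl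
    one false (yes _) = refl
    one false (no _)  = refl

  isAut-flip : ∀ π (G : Graph n) → IsAut G π → IsAut G (flip π)
  isAut-flip π G aut i j = sym (trans (aut _ _) (cong₂ (adj G) (inverseʳ π) (inverseʳ π)))

  -- Counting invariant graphs

  module _ {a : ℕ} (L : HasCardinality (DecSetoid.setoid (LabeledSplit n)) a) where
    open Labeled L

    invariant? : ∀ π g → Dec (IsAut (graph g) π × SplitBy K (graph g))
    invariant? π g = isAut? (graph g) π ×-dec splitBy? K (graph g)

    invariant : Permutation′ n → ℕ
    invariant π = ∑[ g < a ] ⟦ invariant? π g ⟧

    invariant-free : ∀ π → invariant π ≤ 2 ^ count (free? π)
    invariant-free π = count-upper (invariant? π) code inj
      where
      F = count (free? π)

      code : Fin a → Fin (2 ^ F)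
      code g = fromBits (at (graph g) ∘ select (free? π))

      inj : ∀ {g h} → IsAut (graph g) π × SplitBy K (graph g) →
            IsAut (graph h) π × SplitBy K (graph h) → code g ≡ code h → g ≡ h
      inj {g} {h} (autG , byG) (autH , byH) eq =
        graph-injective (free-determines π (graph g) (graph h) byG byH autG autH agree)
        where
        open ≡-Reasoning
        agree : ∀ x → Crossing K x → ¬ Determined π x → at (graph g) x ≡ at (graph h) x
        agree x cr ¬det = begin
          at (graph g) x                          ≡⟨ cong (at (graph g)) (select-rank (free? π) x (cr , ¬det)) ⟨
          at (graph g) (select (free? π) z)       ≡⟨ bits-fromBits (at (graph g) ∘ select (free? π)) z ⟨
          bits F (code g) z                       ≡⟨ cong (λ c → bits F c z) eq ⟩
          bits F (code h) z                       ≡⟨ bits-fromBits (at (graph h) ∘ select (free? π)) z ⟩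
          at (graph h) (select (free? π) z)       ≡⟨ cong (at (graph h)) (select-rank (free? π) x (cr , ¬det)) ⟩
          at (graph h) x                          ∎
          where z = rank (free? π) x (cr , ¬det)

    -- The crossings are free or determined, and only the free ones carry information about an
    -- invariant graph.
    invariant-determined : ∀ π → invariant π * 2 ^ determined π ≤ 2 ^ crossings K
    invariant-determined π = begin
      invariant π * 2 ^ determined π              ≤⟨ *-monoˡ-≤ _ (invariant-free π) ⟩
      2 ^ count (free? π) * 2 ^ determined π      ≡⟨ ^-distribˡ-+-* 2 (count (free? π)) _ ⟨
      2 ^ (count (free? π) + determined π)        ≡⟨ cong (2 ^_) (trans (+-comm (count (free? π)) _)
                                                       (count-split (crossing? K) (determined? π))) ⟩
      2 ^ crossings K                             ∎
      where open ≤-Reasoning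

    invariant-flip : ∀ π → invariant π ≤ invariant (flip π)
    invariant-flip π = sum-mono-≤ λ g → ⟦⟧-mono (invariant? π g) (invariant? (flip π) g)
      λ (aut , by) → isAut-flip π (graph g) aut , by

    private
      support : Permutation′ n → ℕ
      support π = movedIn π true + movedIn π false

      halves : ∀ {k a b} → 2 * k ≤ a + b → k ≤ a ⊎ k ≤ b
      halves {k} {a} {b} le with k ≤? a | k ≤? b
      ... | yes k≤a | _       = inj₁ k≤a
      ... | no _    | yes k≤b = inj₂ k≤b
      ... | no k≰a  | no k≰b  = contradiction
        (≤-trans (+-mono-< (≰⇒> k≰a) (≰⇒> k≰b)) (≤-reflexive (cong (k ℕ.+_) (sym (+-identityʳ k)))))
        (≤⇒≯ le)

      -- Each moved vertex lies in at least 8v moved crossings. Adding the bounds for the two sides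
      -- counts a crossing at most twice, which leaves 4v moved crossings per moved vertex.
      support-determined : ∀ v π → suc (8 * v) ≤ size K true → suc (8 * v) ≤ size K false →
                           2 * (2 * v * support π) ≤ determined π + determined (flip π)
      support-determined v π large₁ large₂ = *-cancelˡ-≤ 2 (begin
        2 * (2 * (2 * v * support π))
          ≡⟨ double-support v (movedIn π true) (movedIn π false) ⟩
        movedIn π true * (8 * v) + movedIn π false * (8 * v)
          ≤⟨ +-mono-≤ (movedIn-clique π large₂) (movedIn-stable π large₁) ⟩
        count (moved? π) + count (moved? π)
          ≡⟨ cong (count (moved? π) ℕ.+_) (+-identityʳ _) ⟨
        2 * count (moved? π)
          ≤⟨ *-monoʳ-≤ 2 (moved≤determined π) ⟩
        2 * (determined π + determined (flip π)) ∎)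
        where open ≤-Reasoning

      -- One of `π` and `flip π` determines at least half of the moved crossings, and passing to the
      -- inverse does not lose invariant graphs.
      invariant-support : ∀ v π → suc (8 * v) ≤ size K true → suc (8 * v) ≤ size K false →
                          invariant π * 2 ^ (2 * v * support π) ≤ 2 ^ crossings K
      invariant-support v π large₁ large₂ =
        [ (λ le → ≤-trans (*-monoʳ-≤ (invariant π) (^-monoʳ-≤ 2 le)) (invariant-determined π))
        , (λ le → ≤-trans (*-mono-≤ (invariant-flip π) (^-monoʳ-≤ 2 le)) (invariant-determined (flip π)))
        ]′ (halves {2 * v * support π} {determined π} {determined (flip π)} (support-determined v π large₁ large₂))

      support≥1 : ∀ π → Nontrivial π → 1 ≤ support π
      support≥1 π (i , πi≢i) = ≤-trans (one (K i) refl) (movedIn≤support (K i))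
        where
        one : ∀ b → K i ≡ b → 1 ≤ movedIn π b
        one b eq = ≤-trans (≤-reflexive (sym (⟦⟧-true (movedIn? π b i) (eq , πi≢i))))
                           (term≤sum (λ i → ⟦ movedIn? π b i ⟧) i)

        movedIn≤support : ∀ b → movedIn π b ≤ support π
        movedIn≤support true  = m≤m+n _ _
        movedIn≤support false = m≤n+m _ _

    -- The exponent 2v · `support π` is split: one half joins v · `fixed π` to make v · n, and the
    -- other is at least v because `π` moves a vertex. What remains on the right is the weight
    -- summed by `∑-fixed` with N = 2^v.
    invariant-fixed : ∀ v π → suc (8 * v) ≤ size K true → suc (8 * v) ≤ size K false → Nontrivial π →
                      invariant π * 2 ^ (v + v * n) ≤ 2 ^ crossings K * (2 ^ v) ^ fixed π
    invariant-fixed v π large₁ large₂ nt = begin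
      invariant π * 2 ^ (v + v * n)
        ≤⟨ *-monoʳ-≤ (invariant π) (^-monoʳ-≤ 2 exponent) ⟩
      invariant π * 2 ^ (2 * v * support π + v * fixed π)
        ≡⟨ cong (invariant π *_) (^-distribˡ-+-* 2 (2 * v * support π) _) ⟩
      invariant π * (2 ^ (2 * v * support π) * 2 ^ (v * fixed π))
        ≡⟨ *-assoc (invariant π) _ _ ⟨
      invariant π * 2 ^ (2 * v * support π) * 2 ^ (v * fixed π)
        ≤⟨ *-mono-≤ (invariant-support v π large₁ large₂) (≤-reflexive (sym (^-*-assoc 2 v (fixed π)))) ⟩
      2 ^ crossings K * (2 ^ v) ^ fixed π ∎
      where
      open ≤-Reasoning
      exponent : v + v * n ≤ 2 * v * support π + v * fixed π
      exponent = begin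
        v + v * n
          ≡⟨ cong (λ n → v + v * n) (sym (movedIn-sum π)) ⟩
        v + v * (support π + fixed π)
          ≤⟨ +-monoˡ-≤ _ (≤-trans (≤-reflexive (sym (*-identityʳ v))) (*-monoʳ-≤ v (support≥1 π nt))) ⟩
        v * support π + v * (support π + fixed π)
          ≡⟨ support-exponent v (support π) (fixed π) ⟩
        2 * v * support π + v * fixed π ∎

-- The number of symmetries

!≤^ : ∀ n → n ! ≤ n ^ n
!≤^ zero    = ≤-refl
!≤^ (suc n) = *-monoʳ-≤ (suc n) (≤-trans (!≤^ n) (^-monoˡ-≤ n (n≤1+n n)))

private
  bernoulli-step : ∀ N a k → (N + a) * (N + 2 * k * a) ≡ N * N + 2 * k * a * N + a * N + a * (2 * k * a)
  bernoulli-step = solve 3 (λ N a k → (N :+ a) :* (N :+ con 2 :* k :* a)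
    := N :* N :+ con 2 :* k :* a :* N :+ a :* N :+ a :* (con 2 :* k :* a)) refl

  bernoulli-step′ : ∀ N a k → N * N + 2 * k * a * N + a * N + a * N ≡ N * (N + 2 * suc k * a)
  bernoulli-step′ = solve 3 (λ N a k → N :* N :+ con 2 :* k :* a :* N :+ a :* N :+ a :* N
    := N :* (N :+ con 2 :* (con 1 :+ k) :* a)) refl

-- (1 + a/N)^k ≤ 1 + 2ka/N whenever 2ka ≤ N.
reverse-bernoulli : ∀ N a k → 2 * k * a ≤ N → (N + a) ^ k * N ≤ N ^ k * (N + 2 * k * a)
reverse-bernoulli N a zero    le = ≤-reflexive (cong (λ x → x + 0) (sym (+-identityʳ N)))
reverse-bernoulli N a (suc k) le = begin
  (N + a) * (N + a) ^ k * N
    ≡⟨ *-assoc (N + a) _ N ⟩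
  (N + a) * ((N + a) ^ k * N)
    ≤⟨ *-monoʳ-≤ (N + a) (reverse-bernoulli N a k le′) ⟩
  (N + a) * (N ^ k * (N + 2 * k * a))
    ≡⟨ solve 3 (λ x y z → x :* (y :* z) := y :* (x :* z)) refl (N + a) (N ^ k) (N + 2 * k * a) ⟩
  N ^ k * ((N + a) * (N + 2 * k * a))
    ≡⟨ cong (N ^ k *_) (bernoulli-step N a k) ⟩
  N ^ k * (N * N + 2 * k * a * N + a * N + a * (2 * k * a))
    ≤⟨ *-monoʳ-≤ (N ^ k) (+-monoʳ-≤ _ (*-monoʳ-≤ a le′)) ⟩
  N ^ k * (N * N + 2 * k * a * N + a * N + a * N)
    ≡⟨ cong (N ^ k *_) (bernoulli-step′ N a k) ⟩
  N ^ k * (N * (N + 2 * suc k * a))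
    ≡⟨ solve 3 (λ x y z → y :* (x :* z) := x :* y :* z) refl N (N ^ k) (N + 2 * suc k * a) ⟩
  N * N ^ k * (N + 2 * suc k * a) ∎
  where
  open ≤-Reasoning
  le′ : 2 * k * a ≤ N
  le′ = ≤-trans (*-monoˡ-≤ a (*-monoʳ-≤ 2 (n≤1+n k))) le

[N+n]^n≤2N^n : ∀ N n .{{_ : NonZero N}} → 2 * n * n ≤ N → (N + n) ^ n ≤ 2 * N ^ n
[N+n]^n≤2N^n N n le = *-cancelʳ-≤ _ _ N (begin
  (N + n) ^ n * N               ≤⟨ reverse-bernoulli N n n le ⟩
  N ^ n * (N + 2 * n * n)       ≤⟨ *-monoʳ-≤ (N ^ n) (+-monoʳ-≤ N le) ⟩
  N ^ n * (N + N)               ≡⟨ solve 2 (λ x y → y :* (x :+ x) := con 2 :* y :* x) refl N (N ^ n) ⟩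
  2 * N ^ n * N                 ∎)
  where open ≤-Reasoning

partition-with : ∀ h d → ∃[ K ] h ≤ size {h + d} K true × d ≤ size K false
partition-with h d = K
  , count-lower (λ i → K i Bool.≟ true) (_↑ˡ d) (Fin.↑ˡ-injective d _ _)
      (λ i → cong side (Fin.splitAt-↑ˡ h i d))
  , count-lower (λ i → K i Bool.≟ false) (h ↑ʳ_) (Fin.↑ʳ-injective h _ _)
      (λ i → cong side (Fin.splitAt-↑ʳ h d i))
  where
  side : Fin h ⊎ Fin d → Bool
  side = [ const true , const false ]′
  K : Fin (h + d) → Bool
  K i = side (splitAt h i)

-- Symmetries against labeled split graphs

module Estimate {n a : ℕ} (L : HasCardinality (DecSetoid.setoid (LabeledSplit n)) a) where
  open Labeled L

  private
    nt? : ∀ c → Dec (Nontrivial (perm n c))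
    nt? c = nontrivial? (perm n c)

    aut? : ∀ g c → Dec (IsAut (graph g) (perm n c))
    aut? g c = isAut? (graph g) (perm n c)

  symmetries : ℕ
  symmetries = ∑[ g < a ] ∑[ c < n ! ] ⟦ nt? c ×-dec aut? g c ⟧

  symmetriesBy : (Fin n → Bool) → ℕ
  symmetriesBy K = ∑[ c < n ! ] (⟦ nontrivial? (perm n c) ⟧ * invariant K L (perm n c))

  bipartitions : ℕ
  bipartitions = ∑[ k < 2 ^ n ] (2 ^ crossings (bits n k))

  -- Double counting of the pairs of a partition and a graph split by it.
  bipartitions≤ : bipartitions ≤ a * (suc n * suc n)
  bipartitions≤ = begin
    bipartitions
      ≤⟨ sum-mono-≤ (λ k → splitBy-count L (bits n k)) ⟩
    ∑[ k < 2 ^ n ] ∑[ g < a ] ⟦ splitBy? (bits n k) (graph g) ⟧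
      ≡⟨ ∑-comm {2 ^ n} {a} (λ k g → ⟦ splitBy? (bits n k) (graph g) ⟧) ⟩
    ∑[ g < a ] partitions (graph g)
      ≤⟨ sum-upper (λ g → partitions-≤ (graph g) (graph-isSplit g)) ⟩
    a * (suc n * suc n) ∎
    where open ≤-Reasoning

  bipartitions≥ : ∀ K → 2 ^ crossings K ≤ bipartitions
  bipartitions≥ K = ≤-trans (≤-reflexive (cong (2 ^_) same)) (term≤sum {2 ^ n} (λ k → 2 ^ crossings (bits n k)) code)
    where
    code : Fin (2 ^ n)
    code = fromBits K

    same-size : ∀ b → size K b ≡ size (bits n code) b
    same-size b = sum-cong-≗ {n} λ i → cong (λ x → ⟦ x Bool.≟ b ⟧) (sym (bits-fromBits K i))

    same : crossings K ≡ crossings (bits n code)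
    same = trans (crossings-size K)
      (trans (cong₂ _*_ (same-size true) (same-size false)) (sym (crossings-size (bits n code))))

  -- Every split graph has a partition, so charging a symmetry to all partitions of its graph can
  -- only enlarge the sum.
  symmetries≤ : symmetries ≤ ∑[ k < 2 ^ n ] symmetriesBy (bits n k)
  symmetries≤ = begin
    ∑[ g < a ] ∑[ c < n ! ] ⟦ nt? c ×-dec aut? g c ⟧
      ≤⟨ sum-mono-≤ (λ g → sum-mono-≤ λ c → choose g c) ⟩
    ∑[ g < a ] ∑[ c < n ! ] ∑[ k < 2 ^ n ] (⟦ nt? c ⟧ * ⟦ inv? g c k ⟧)
      ≡⟨ sum-cong-≗ (λ g → ∑-comm {n !} {2 ^ n} (λ c k → ⟦ nt? c ⟧ * ⟦ inv? g c k ⟧)) ⟩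
    ∑[ g < a ] ∑[ k < 2 ^ n ] ∑[ c < n ! ] (⟦ nt? c ⟧ * ⟦ inv? g c k ⟧)
      ≡⟨ ∑-comm {a} {2 ^ n} (λ g k → ∑[ c < n ! ] (⟦ nt? c ⟧ * ⟦ inv? g c k ⟧)) ⟩
    ∑[ k < 2 ^ n ] ∑[ g < a ] ∑[ c < n ! ] (⟦ nt? c ⟧ * ⟦ inv? g c k ⟧)
      ≡⟨ sum-cong-≗ (λ k → ∑-comm {a} {n !} (λ g c → ⟦ nt? c ⟧ * ⟦ inv? g c k ⟧)) ⟩
    ∑[ k < 2 ^ n ] ∑[ c < n ! ] ∑[ g < a ] (⟦ nt? c ⟧ * ⟦ inv? g c k ⟧)
      ≡⟨ sum-cong-≗ (λ k → sum-cong-≗ λ c → sym (*-distribˡ-sum ⟦ nt? c ⟧ (λ g → ⟦ inv? g c k ⟧))) ⟩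
    ∑[ k < 2 ^ n ] symmetriesBy (bits n k) ∎
    where
    open ≤-Reasoning
    inv? : ∀ g c k → Dec (IsAut (graph g) (perm n c) × SplitBy (bits n k) (graph g))
    inv? g c k = invariant? (bits n k) L (perm n c) g

    choose : ∀ g c → ⟦ nt? c ×-dec aut? g c ⟧ ≤ ∑[ k < 2 ^ n ] (⟦ nt? c ⟧ * ⟦ inv? g c k ⟧)
    choose g c = begin
      ⟦ nt? c ×-dec aut? g c ⟧
        ≡⟨ trans (⟦⟧-× (nt? c) (aut? g c)) (sym (*-identityʳ _)) ⟩
      ⟦ nt? c ⟧ * ⟦ aut? g c ⟧ * 1
        ≤⟨ *-monoʳ-≤ (⟦ nt? c ⟧ * ⟦ aut? g c ⟧) (partitions≥1 (graph g) (graph-isSplit g)) ⟩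
      ⟦ nt? c ⟧ * ⟦ aut? g c ⟧ * partitions (graph g)
        ≡⟨ *-distribˡ-sum (⟦ nt? c ⟧ * ⟦ aut? g c ⟧) (λ k → ⟦ splitBy? (bits n k) (graph g) ⟧) ⟩
      ∑[ k < 2 ^ n ] (⟦ nt? c ⟧ * ⟦ aut? g c ⟧ * ⟦ splitBy? (bits n k) (graph g) ⟧)
        ≡⟨ sum-cong-≗ (λ k → trans (*-assoc ⟦ nt? c ⟧ _ _)
             (cong (⟦ nt? c ⟧ *_) (sym (⟦⟧-× (aut? g c) (splitBy? (bits n k) (graph g)))))) ⟩
      ∑[ k < 2 ^ n ] (⟦ nt? c ⟧ * ⟦ inv? g c k ⟧) ∎

  automorphisms≤ : ∑[ g < a ] ∑[ c < n ! ] ⟦ isAut? (graph g) (perm n c) ⟧ ≤ a + symmetries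
  automorphisms≤ = begin
    ∑[ g < a ] ∑[ c < n ! ] ⟦ aut? g c ⟧
      ≤⟨ sum-mono-≤ (λ g → sum-mono-≤ λ c → trivial-or (nt? c) (aut? g c)) ⟩
    ∑[ g < a ] ∑[ c < n ! ] (⟦ ¬? (nt? c) ⟧ + ⟦ nt? c ×-dec aut? g c ⟧)
      ≡⟨ sum-cong-≗ (λ g → ∑-distrib-+ (λ c → ⟦ ¬? (nt? c) ⟧) (λ c → ⟦ nt? c ×-dec aut? g c ⟧)) ⟩
    ∑[ g < a ] (∑[ c < n ! ] ⟦ ¬? (nt? c) ⟧ + ∑[ c < n ! ] ⟦ nt? c ×-dec aut? g c ⟧)
      ≡⟨ ∑-distrib-+ {a} (λ g → ∑[ c < n ! ] ⟦ ¬? (nt? c) ⟧) (λ g → ∑[ c < n ! ] ⟦ nt? c ×-dec aut? g c ⟧) ⟩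
    ∑[ g < a ] ∑[ c < n ! ] ⟦ ¬? (nt? c) ⟧ + symmetries
      ≤⟨ +-monoˡ-≤ symmetries (≤-trans (sum-upper {a} (λ g → count-trivial n)) (≤-reflexive (*-identityʳ a))) ⟩
    a + symmetries ∎
    where
    open ≤-Reasoning
    trivial-or : {A B : Set} (a? : Dec A) (b? : Dec B) → ⟦ b? ⟧ ≤ ⟦ ¬? a? ⟧ + ⟦ a? ×-dec b? ⟧
    trivial-or (yes _) (yes _) = ≤-refl
    trivial-or (yes _) (no _)  = z≤n
    trivial-or (no _)  b?      = ≤-trans (⟦⟧≤1 b?) (m≤m+n 1 0)

  labeled≥1 : 1 ≤ a
  labeled≥1 = begin
    1                              ≤⟨ m^n>0 2 (crossings K) ⟩
    2 ^ crossings K                ≤⟨ splitBy-count L K ⟩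
    count (λ g → splitBy? K (graph g)) ≤⟨ count-≤ (λ g → splitBy? K (graph g)) ⟩
    a                              ∎
    where
    open ≤-Reasoning
    K : Fin n → Bool
    K _ = true

  -- `invariant-fixed` is summed over all permutations; `small` is the condition under which (N +
  -- n)^n ≤ 2N^n for N = 2^v, so the summation costs only a factor 2.
  symmetriesBy-balanced : ∀ K v → suc (8 * v) ≤ size K true → suc (8 * v) ≤ size K false →
                          2 * n * n ≤ 2 ^ v → symmetriesBy K * 2 ^ v ≤ 2 * 2 ^ crossings K
  symmetriesBy-balanced K v large₁ large₂ small = *-cancelʳ-≤ _ _ (2 ^ (v * n)) {{m^n≢0 2 (v * n)}} (begin
    symmetriesBy K * 2 ^ v * 2 ^ (v * n)
      ≡⟨ trans (*-assoc (symmetriesBy K) _ _) (cong (symmetriesBy K *_) (sym (^-distribˡ-+-* 2 v (v * n)))) ⟩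
    symmetriesBy K * M
      ≡⟨ *-distribʳ-sum M (λ c → ⟦ nontrivial? (perm n c) ⟧ * invariant K L (perm n c)) ⟩
    ∑[ c < n ! ] (⟦ nontrivial? (perm n c) ⟧ * invariant K L (perm n c) * M)
      ≤⟨ sum-mono-≤ (λ c → term (perm n c) (nontrivial? (perm n c))) ⟩
    ∑[ c < n ! ] (2 ^ crossings K * (2 ^ v) ^ fixed (perm n c))
      ≡⟨ *-distribˡ-sum (2 ^ crossings K) (λ c → (2 ^ v) ^ fixed (perm n c)) ⟨
    2 ^ crossings K * ∑[ c < n ! ] ((2 ^ v) ^ fixed (perm n c))
      ≤⟨ *-monoʳ-≤ (2 ^ crossings K) (≤-trans (∑-fixed n (2 ^ v) {{m^n≢0 2 v}}) ([N+n]^n≤2N^n (2 ^ v) n {{m^n≢0 2 v}} small)) ⟩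
    2 ^ crossings K * (2 * (2 ^ v) ^ n)
      ≡⟨ cong (λ x → 2 ^ crossings K * (2 * x)) (^-*-assoc 2 v n) ⟩
    2 ^ crossings K * (2 * 2 ^ (v * n))
      ≡⟨ trans (sym (*-assoc (2 ^ crossings K) 2 _)) (cong (_* 2 ^ (v * n)) (*-comm (2 ^ crossings K) 2)) ⟩
    2 * 2 ^ crossings K * 2 ^ (v * n) ∎)
    where
    open ≤-Reasoning
    M = 2 ^ (v + v * n)

    term : ∀ π (d : Dec (Nontrivial π)) →
           ⟦ d ⟧ * invariant K L π * M ≤ 2 ^ crossings K * (2 ^ v) ^ fixed π
    term π (yes nt) = ≤-trans (≤-reflexive (cong (_* M) (+-identityʳ (invariant K L π))))
                              (invariant-fixed K L v π large₁ large₂ nt)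
    term π (no _)   = z≤n

  -- A crude bound that ignores the effect of invariance, meant for the unbalanced partitions.
  symmetriesBy-≤ : ∀ K → symmetriesBy K ≤ n ! * 2 ^ crossings K
  symmetriesBy-≤ K = sum-upper λ c → begin
    ⟦ nontrivial? (perm n c) ⟧ * invariant K L (perm n c)
      ≤⟨ *-monoˡ-≤ _ (⟦⟧≤1 (nontrivial? (perm n c))) ⟩
    1 * invariant K L (perm n c)
      ≡⟨ *-comm 1 (invariant K L (perm n c)) ⟩
    invariant K L (perm n c) * 1
      ≤⟨ *-monoʳ-≤ (invariant K L (perm n c)) (m^n>0 2 (determined K (perm n c))) ⟩
    invariant K L (perm n c) * 2 ^ determined K (perm n c)
      ≤⟨ invariant-determined K L (perm n c) ⟩
    2 ^ crossings K ∎
    where open ≤-Reasoning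

  crossings-unbalanced : ∀ K t → size K true ≤ t ⊎ size K false ≤ t → crossings K ≤ t * n
  crossings-unbalanced K t (inj₁ le) = ≤-trans (≤-reflexive (crossings-size K))
    (*-mono-≤ le (count-≤ (λ i → K i Bool.≟ false)))
  crossings-unbalanced K t (inj₂ le) = ≤-trans (≤-reflexive (trans (crossings-size K) (*-comm (size K true) _)))
    (*-mono-≤ le (count-≤ (λ i → K i Bool.≟ true)))

  module _ (v : ℕ) (v≥1 : 1 ≤ v) (64v≤n : v * 64 ≤ n) (small : 2 * n * n ≤ 2 ^ v) where

    private
      n≥1 : 1 ≤ n
      n≥1 = ≤-trans (≤-trans v≥1 (m≤m*n v 64)) 64v≤n

      n≤2^v : n ≤ 2 ^ v
      n≤2^v = ≤-trans (≤-trans (m≤n*m n (2 * n) {{>-nonZero (≤-trans n≥1 (m≤n*m n 2))}}) ≤-refl) small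

      !≤2^ : n ! ≤ 2 ^ (v * n)
      !≤2^ = ≤-trans (!≤^ n) (≤-trans (^-monoˡ-≤ n n≤2^v) (≤-reflexive (^-*-assoc 2 v n)))

      -- The summands are the exponents to be absorbed: 8vn for the crossings of an unbalanced
      -- partition, vn for n!, v for the gain 2^v, and n for the number of partitions. A clique side
      -- of 32v vertices leaves d ≥ n/2 for the stable side, hence at least 16vn crossings.
      half : ∃[ K ] 8 * (v * n) + v * n + v + n ≤ crossings {n} K
      half with d , refl ← m≤n⇒∃[o]m+o≡n (≤-trans (*-monoʳ-≤ v {32} {64} (m≤m+n 32 32)) 64v≤n)
           with K , h≤ , d≤ ← partition-with (v * 32) d
           = K , (begin
        8 * (v * n′) + v * n′ + v + n′
          ≤⟨ +-mono-≤ (+-monoʳ-≤ _ (m≤m*n v n′ {{>-nonZero n≥1}})) (m≤n*m n′ v {{>-nonZero v≥1}}) ⟩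
        8 * (v * n′) + v * n′ + v * n′ + v * n′
          -- The exponents total at most 11vn; the slack of 5vn reaches 16vn.
          ≤⟨ m≤m+n _ (5 * (v * n′)) ⟩
        8 * (v * n′) + v * n′ + v * n′ + v * n′ + 5 * (v * n′)
          ≡⟨ solve 3 (λ v h d → let x = v :* (h :+ d) in con 8 :* x :+ x :+ x :+ x :+ con 5 :* x
                                := v :* con 16 :* (h :+ d)) refl v (v * 32) d ⟩
        v * 16 * (v * 32 + d)
          ≤⟨ *-monoʳ-≤ (v * 16) (+-monoˡ-≤ d h≤d) ⟩
        v * 16 * (d + d)
          ≡⟨ solve 2 (λ v d → v :* con 16 :* (d :+ d) := v :* con 32 :* d) refl v d ⟩
        v * 32 * d
          ≤⟨ *-mono-≤ h≤ d≤ ⟩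
        size K true * size K false
          ≡⟨ crossings-size K ⟨
        crossings K ∎)
        where
        open ≤-Reasoning
        n′ = v * 32 + d
        h≤d : v * 32 ≤ d
        h≤d = +-cancelˡ-≤ (v * 32) _ _ (≤-trans (≤-reflexive (sym (*-distribˡ-+ v 32 32))) 64v≤n)

    symmetriesBy-unbalanced : ∀ K → size K true ≤ 8 * v ⊎ size K false ≤ 8 * v →
                              symmetriesBy K * 2 ^ v * 2 ^ n ≤ bipartitions
    symmetriesBy-unbalanced K unb = begin
      symmetriesBy K * 2 ^ v * 2 ^ n
        ≤⟨ *-monoˡ-≤ (2 ^ n) (*-monoˡ-≤ (2 ^ v) (≤-trans (symmetriesBy-≤ K)
             (*-mono-≤ !≤2^ (^-monoʳ-≤ 2 (crossings-unbalanced K (8 * v) unb))))) ⟩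
      2 ^ (v * n) * 2 ^ (8 * v * n) * 2 ^ v * 2 ^ n
        ≡⟨ cong (λ x → x * 2 ^ v * 2 ^ n) (sym (^-distribˡ-+-* 2 (v * n) _)) ⟩
      2 ^ (v * n + 8 * v * n) * 2 ^ v * 2 ^ n
        ≡⟨ cong (_* 2 ^ n) (sym (^-distribˡ-+-* 2 (v * n + 8 * v * n) v)) ⟩
      2 ^ (v * n + 8 * v * n + v) * 2 ^ n
        ≡⟨ ^-distribˡ-+-* 2 (v * n + 8 * v * n + v) n ⟨
      2 ^ (v * n + 8 * v * n + v + n)
        ≡⟨ cong (λ x → 2 ^ (x + v + n)) (trans (+-comm (v * n) _) (cong (_+ v * n) (*-assoc 8 v n))) ⟩
      2 ^ (8 * (v * n) + v * n + v + n)
        ≤⟨ ^-monoʳ-≤ 2 (proj₂ half) ⟩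
      2 ^ crossings (proj₁ half)
        ≤⟨ bipartitions≥ (proj₁ half) ⟩
      bipartitions ∎
      where open ≤-Reasoning

    -- The factor 2^n lets each of the 2^n partitions be charged with a full copy of `bipartitions`,
    -- so balanced and unbalanced ones can be summed together.
    symmetriesBy-bound : ∀ K → symmetriesBy K * 2 ^ v * 2 ^ n ≤ 2 * 2 ^ crossings K * 2 ^ n + bipartitions
    symmetriesBy-bound K = bound (suc (8 * v) ≤? size K true) (suc (8 * v) ≤? size K false)
      where
      bound : Dec (suc (8 * v) ≤ size K true) → Dec (suc (8 * v) ≤ size K false) →
              symmetriesBy K * 2 ^ v * 2 ^ n ≤ 2 * 2 ^ crossings K * 2 ^ n + bipartitions
      bound (yes large₁) (yes large₂) = ≤-trans
        (*-monoˡ-≤ (2 ^ n) (symmetriesBy-balanced K v large₁ large₂ small)) (m≤m+n _ bipartitions)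
      bound (yes _) (no small₂) = ≤-trans (symmetriesBy-unbalanced K (inj₂ (≮⇒≥ small₂))) (m≤n+m bipartitions _)
      bound (no small₁) _       = ≤-trans (symmetriesBy-unbalanced K (inj₁ (≮⇒≥ small₁))) (m≤n+m bipartitions _)

    -- The 3 is 2 from the balanced partitions plus 1 from the unbalanced ones.
    symmetries-bound : symmetries * 2 ^ v ≤ 3 * bipartitions
    symmetries-bound = *-cancelʳ-≤ _ _ (2 ^ n) {{m^n≢0 2 n}} (begin
      symmetries * 2 ^ v * 2 ^ n
        ≤⟨ *-monoˡ-≤ (2 ^ n) (*-monoˡ-≤ (2 ^ v) symmetries≤) ⟩
      ∑[ k < 2 ^ n ] symmetriesBy (bits n k) * 2 ^ v * 2 ^ n
        ≡⟨ cong (_* 2 ^ n) (*-distribʳ-sum (2 ^ v) (λ k → symmetriesBy (bits n k))) ⟩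
      ∑[ k < 2 ^ n ] (symmetriesBy (bits n k) * 2 ^ v) * 2 ^ n
        ≡⟨ *-distribʳ-sum (2 ^ n) (λ k → symmetriesBy (bits n k) * 2 ^ v) ⟩
      ∑[ k < 2 ^ n ] (symmetriesBy (bits n k) * 2 ^ v * 2 ^ n)
        ≤⟨ sum-mono-≤ (λ k → symmetriesBy-bound (bits n k)) ⟩
      ∑[ k < 2 ^ n ] (2 * 2 ^ crossings (bits n k) * 2 ^ n + bipartitions)
        ≡⟨ ∑-distrib-+ (λ k → 2 * 2 ^ crossings (bits n k) * 2 ^ n) (λ _ → bipartitions) ⟩
      ∑[ k < 2 ^ n ] (2 * 2 ^ crossings (bits n k) * 2 ^ n) + ∑[ k < 2 ^ n ] bipartitions
        ≡⟨ cong₂ _+_ (trans (sym (*-distribʳ-sum (2 ^ n) (λ k → 2 * 2 ^ crossings (bits n k))))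
                            (cong (_* 2 ^ n) (sym (*-distribˡ-sum 2 (λ k → 2 ^ crossings (bits n k))))))
                     (sum-const (2 ^ n) bipartitions) ⟩
      2 * bipartitions * 2 ^ n + 2 ^ n * bipartitions
        ≡⟨ solve 2 (λ p x → con 2 :* p :* x :+ x :* p := con 3 :* p :* x) refl bipartitions (2 ^ n) ⟩
      3 * bipartitions * 2 ^ n ∎)
      where open ≤-Reasoning

-- Asymptotics

n<2^n : ∀ n → n < 2 ^ n
n<2^n zero    = s≤s z≤n
n<2^n (suc n) = ≤-trans (+-mono-≤ (m^n>0 2 n) (n<2^n n)) (≤-reflexive (cong (λ x → 2 ^ n + x) (sym (+-identityʳ (2 ^ n)))))

-- The three linear factors contribute 3(w + 8) to the exponent and the constant, rounded up to 4,
-- contributes 2. The total 3w + 26 fits below 4w once w ≥ 26.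
cubic≤2^ : ∀ n w → 26 ≤ w → n < 2 ^ (w + 8) → 3 * n * (suc n * suc n) ≤ 2 ^ (w * 4)
cubic≤2^ n w 26≤w n<2^ = begin
  3 * n * (suc n * suc n)
    ≤⟨ *-mono-≤ (*-mono-≤ {3} {4} (n≤1+n 3) (<⇒≤ n<2^)) (*-mono-≤ n<2^ n<2^) ⟩
  4 * x * (x * x)
    ≡⟨ solve 1 (λ x → con 4 :* x :* (x :* x) := x :* x :* x :* con 4) refl x ⟩
  x * x * x * 2 ^ 2
    ≡⟨ cong (λ y → y * x * 2 ^ 2) (^-distribˡ-+-* 2 e e) ⟨
  2 ^ (e + e) * x * 2 ^ 2
    ≡⟨ cong (_* 2 ^ 2) (^-distribˡ-+-* 2 (e + e) e) ⟨
  2 ^ (e + e + e) * 2 ^ 2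
    ≡⟨ ^-distribˡ-+-* 2 (e + e + e) 2 ⟨
  2 ^ (e + e + e + 2)
    ≤⟨ ^-monoʳ-≤ 2 exponent ⟩
  2 ^ (w * 4) ∎
  where
  open ≤-Reasoning
  e = w + 8
  x = 2 ^ e

  exponent : e + e + e + 2 ≤ w * 4
  exponent = begin
    e + e + e + 2  ≡⟨ solve 1 (λ w → (w :+ con 8) :+ (w :+ con 8) :+ (w :+ con 8) :+ con 2
                                  := w :* con 3 :+ con 26) refl w ⟩
    w * 3 + 26     ≤⟨ +-monoʳ-≤ (w * 3) 26≤w ⟩
    w * 3 + w      ≡⟨ trans (+-comm (w * 3) w) (sym (*-suc w 3)) ⟩
    w * 4          ∎

n<2^[n/256+8] : ∀ n → n < 2 ^ (n ℕ./ 256 + 8)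
n<2^[n/256+8] n = begin-strict
  n                                 ≡⟨ m≡m%n+[m/n]*n n 256 ⟩
  n ℕ.% 256 + n ℕ./ 256 * 256       <⟨ +-monoˡ-< (n ℕ./ 256 * 256) (m%n<n n 256) ⟩
  suc (n ℕ./ 256) * 256             ≤⟨ *-monoˡ-≤ 256 (n<2^n (n ℕ./ 256)) ⟩
  2 ^ (n ℕ./ 256) * 2 ^ 8           ≡⟨ ^-distribˡ-+-* 2 (n ℕ./ 256) 8 ⟨
  2 ^ (n ℕ./ 256 + 8)               ∎
  where open ≤-Reasoning

module _ (n w : ℕ) (26≤w : 26 ≤ w) (n<2^ : n < 2 ^ (w + 8)) (w*256≤n : w * 256 ≤ n) where

  -- With v = 4w, 2^v exceeds 3n(n + 1)²: the part 3(n + 1)² cancels the losses in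
  -- `symmetries-bound` and `bipartitions≤`, and the factor n survives. The condition 64v ≤ n
  -- becomes 256w ≤ n.
  few-symmetries : ∀ {a} (L : HasCardinality (DecSetoid.setoid (LabeledSplit n)) a) →
                   n * Estimate.symmetries L ≤ a
  few-symmetries {a} L = *-cancelʳ-≤ _ _ (3 * (suc n * suc n)) (begin
    n * E * (3 * (suc n * suc n))
      ≡⟨ solve 3 (λ n e q → n :* e :* (con 3 :* q) := e :* (con 3 :* n :* q)) refl n E (suc n * suc n) ⟩
    E * (3 * n * (suc n * suc n))
      ≤⟨ *-monoʳ-≤ E (cubic≤2^ n w 26≤w n<2^) ⟩
    E * 2 ^ (w * 4)
      ≤⟨ symmetries-bound (w * 4) (≤-trans (≤-trans (s≤s z≤n) 26≤w) (m≤m*n w 4)) 64v≤n small ⟩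
    3 * bipartitions
      ≤⟨ *-monoʳ-≤ 3 bipartitions≤ ⟩
    3 * (a * (suc n * suc n))
      ≡⟨ solve 2 (λ a q → con 3 :* (a :* q) := a :* (con 3 :* q)) refl a (suc n * suc n) ⟩
    a * (3 * (suc n * suc n)) ∎)
    where
    open ≤-Reasoning
    open Estimate L
    E = symmetries
    64v≤n : w * 4 * 64 ≤ n
    64v≤n = ≤-trans (≤-reflexive (*-assoc w 4 64)) w*256≤n

    small : 2 * n * n ≤ 2 ^ (w * 4)
    small = ≤-trans (*-mono-≤ {2 * n} (*-monoˡ-≤ n (m≤m+n 2 1)) (≤-trans (n≤1+n n) (m≤m*n (suc n) (suc n)))) (cubic≤2^ n w 26≤w n<2^)

-- The quotient lies in [1 , 1 + ε) as soon as 1/n < ε; both bounds are checked after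
-- multiplication by a/D.
ratio-close : ∀ (a b D n e : ℕ) .{{_ : NonZero D}} → 1 ≤ a → a ≤ b * D → b * D ≤ a + e → n * e ≤ a →
              ∀ (ε : ℚ) .{{_ : ℚ.Positive ε}} → ↧ₙ ε < n →
              Σ[ y≢0 ∈ ℚ.NonZero (+ a / D) ] ℚ.∣ ((+ b / 1) ℚ.÷ (+ a / D)) {{y≢0}} ℚ.- 1ℚ ∣ ℚ.< ε
ratio-close a@(suc _) b D@(suc k) n e _ lower upper small ε@(mkℚ +[1+ p ] d-1 _) d<n =
  y≢0 , subst (ℚ._< ε) (sym (ℚ.0≤p⇒∣p∣≡p 0≤q-1)) q-1<ε
  where
  x y : ℚ
  x = + b / 1
  y = + a / D
  d = suc d-1

  instance
    y>0 : ℚ.Positive y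
    y>0 = ℚ.normalize-pos a D
    y≥0 : ℚ.NonNegative y
    y≥0 = ℚ.pos⇒nonNeg y
    y≢0 : ℚ.NonZero y
    y≢0 = ℚ.pos⇒nonZero y

  q : ℚ
  q = x ℚ.÷ y

  q*y : q ℚ.* y ≡ x
  q*y = trans (ℚ.*-assoc x (ℚ.1/ y) y) (trans (cong (x ℚ.*_) (ℚ.*-inverseˡ y)) (ℚ.*-identityʳ x))

  xᵘ : toℚᵘ x ℚᵘ.≃ mkℚᵘ (+ b) 0
  xᵘ = ℚ.toℚᵘ-fromℚᵘ (mkℚᵘ (+ b) 0)

  yᵘ : toℚᵘ y ℚᵘ.≃ mkℚᵘ (+ a) k
  yᵘ = ℚ.toℚᵘ-fromℚᵘ (mkℚᵘ (+ a) k)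

  y≤x : y ℚ.≤ x
  y≤x = ℚ.toℚᵘ-cancel-≤ (ℚᵘ.≤-respˡ-≃ (ℚᵘ.≃-sym yᵘ) (ℚᵘ.≤-respʳ-≃ (ℚᵘ.≃-sym xᵘ)
    (*≤* (subst₂ ℤ._≤_ (trans (cong +_ (sym (*-identityʳ a))) (ℤ.pos-* a 1)) (ℤ.pos-* b D) (ℤ.+≤+ lower)))))

  1+εᵘ : ℚᵘ.ℚᵘ
  1+εᵘ = mkℚᵘ (+ (d + suc p)) d-1

  1+ε≃ : toℚᵘ (1ℚ ℚ.+ ε) ℚᵘ.≃ 1+εᵘ
  1+ε≃ = ℚᵘ.≃-trans (ℚ.toℚᵘ-homo-+ 1ℚ ε) (ℚᵘ.≃-reflexive
    (cong₂ mkℚᵘ (cong +_ (cong₂ _+_ (*-identityˡ d) (*-identityʳ (suc p)))) (+-identityʳ d-1)))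

  de<a : d * e < a
  de<a = lemma e small
    where
    lemma : ∀ e → n * e ≤ a → d * e < a
    -- For e = 0 multiplying d < n by e gives no strict inequality; strictness comes from a ≥ 1.
    lemma zero    _  = subst (_< a) (sym (*-zeroʳ d)) (s≤s z≤n)
    lemma (suc e) le = ≤-trans (*-monoˡ-< (suc e) d<n) le

  bound : b * (d * D) < (d + suc p) * a
  bound = begin-strict
    b * (d * D)          ≡⟨ solve 3 (λ b d D → b :* (d :* D) := d :* (b :* D)) refl b d D ⟩
    d * (b * D)          ≤⟨ *-monoʳ-≤ d upper ⟩
    d * (a + e)          ≡⟨ *-distribˡ-+ d a e ⟩
    d * a + d * e        <⟨ +-monoʳ-< (d * a) de<a ⟩
    -- The numerator of ε is at least 1, that is, ε ≥ 1/d.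
    d * a + a            ≤⟨ +-monoʳ-≤ (d * a) (m≤n*m a (suc p)) ⟩
    d * a + suc p * a    ≡⟨ *-distribʳ-+ a d (suc p) ⟨
    (d + suc p) * a      ∎
    where open ≤-Reasoning

  x<[1+ε]y : x ℚ.< (1ℚ ℚ.+ ε) ℚ.* y
  x<[1+ε]y = ℚ.toℚᵘ-cancel-< (ℚᵘ.<-respˡ-≃ (ℚᵘ.≃-sym xᵘ) (ℚᵘ.<-respʳ-≃ (ℚᵘ.≃-sym
      (ℚᵘ.≃-trans (ℚ.toℚᵘ-homo-* (1ℚ ℚ.+ ε) y) (ℚᵘ.*-cong 1+ε≃ yᵘ)))
    (*<* (subst₂ ℤ._<_ (ℤ.pos-* b (d * D)) (trans (ℤ.pos-* (d + suc p) a) (sym (ℤ.*-identityʳ _))) (ℤ.+<+ bound)))))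

  1≤q : 1ℚ ℚ.≤ q
  1≤q = ℚ.*-cancelʳ-≤-pos y (subst₂ ℚ._≤_ (sym (ℚ.*-identityˡ y)) (sym q*y) y≤x)

  q<1+ε : q ℚ.< 1ℚ ℚ.+ ε
  q<1+ε = ℚ.*-cancelʳ-<-nonNeg y (subst (ℚ._< (1ℚ ℚ.+ ε) ℚ.* y) (sym q*y) x<[1+ε]y)

  0≤q-1 : 0ℚ ℚ.≤ q ℚ.- 1ℚ
  0≤q-1 = ℚ.+-monoˡ-≤ (ℚ.- 1ℚ) 1≤q

  q-1<ε : q ℚ.- 1ℚ ℚ.< ε
  q-1<ε = subst (q ℚ.- 1ℚ ℚ.<_) eq (ℚ.+-monoˡ-< (ℚ.- 1ℚ) q<1+ε)
    where
    eq : (1ℚ ℚ.+ ε) ℚ.- 1ℚ ≡ ε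
    eq = trans (cong (ℚ._- 1ℚ) (ℚ.+-comm 1ℚ ε))
      (trans (ℚ.+-assoc ε 1ℚ (ℚ.- 1ℚ)) (ℚ.+-identityʳ ε))

corollary3p11 : (λ n → + s̃ n / 1) ∼ (λ n → (+ s n / n !) {{n !≢0}})
-- The first bound forces `n / 256` to be at least 26; the second puts n above the denominator of ε,
-- so that 1/n < ε.
corollary3p11 ε 0<ε = (26 * 256) ⊔ suc (↧ₙ ε) , λ n n≥N →
  let L = proj₂ (labeledSplit-finite n)
      U = proj₂ (unlabeledSplit-finite n)
      26≤w = ≤-trans (≤-reflexive (sym (m*n/n≡m 26 256)))
               (/-monoˡ-≤ 256 (≤-trans (m≤m⊔n (26 * 256) (suc (↧ₙ ε))) n≥N))
  in ratio-close (s n) (s̃ n) (n !) n (Estimate.symmetries L) {{n !≢0}}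
       (Estimate.labeled≥1 L)
       (Burnside.labeled≤unlabeled*! L U)
       (≤-trans (Burnside.unlabeled*!≤automorphisms L U) (Estimate.automorphisms≤ L))
       (few-symmetries n (n ℕ./ 256) 26≤w (n<2^[n/256+8] n) (m/n*n≤m n 256) L)
       ε {{ℚ.positive 0<ε}} (≤-trans (m≤n⊔m (26 * 256) (suc (↧ₙ ε))) n≥N)
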